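{- The first uncountable ordinal $\omega_1$ is transcendental, that is, with the Nim operations the set $\omega_1$ of all countable ordinals is an algebraically closed field.
   Context: $\oplus$ and $\otimes$ denote Nim-sum and Nim-product of ordinals, defined recursively by $\alpha \oplus \beta = \operatorname{mex}\{\alpha' \oplus \beta, \alpha \oplus \beta' \mid \alpha'<\alpha, \beta'<\beta\}$ and $\alpha \otimes \beta = \operatorname{mex}\{(\alpha' \otimes \beta) \oplus (\alpha \otimes \beta') \oplus (\alpha' \otimes \beta') \mid \alpha'<\alpha, \beta'<\beta\}$, where $\operatorname{mex}(S)$ is the least ordinal not in $S$. With these operations the class of ordinals is a Field of characteristic 2, denoted $\mathrm{On}_2$. An ordinal is identified with the set of smaller ordinals. An ordinal is called transcendental if it is an algebraically closed subfield of $\mathrm{On}_2$. -}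

module Defs where

open import Level using (Level; _⊔_; 0ℓ) renaming (suc to lsuc)
open import Algebra.Bundles using (CommutativeRing)
open import Algebra.Core using (Op₁; Op₂)
import Algebra.Properties.Monoid.Sum as MonoidSum
import Algebra.Properties.Semiring.Exp as SemiringExp
open import Algebra.Structures using (IsCommutativeRing)
open import Axiom.ExcludedMiddle using (ExcludedMiddle)
open import Data.Empty using (⊥)
open import Data.Fin.Base using (Fin; toℕ; fromℕ)
open import Data.Maybe.Base using (Maybe; just; nothing)
open import Data.Nat.Base using (ℕ; suc)
open import Data.Product.Base using (Σ; Σ-syntax; ∃; ∃-syntax; _×_; _,_; proj₁; proj₂)
open import Data.Sum.Base using (_⊎_; inj₁; inj₂; [_,_])
open import Data.Unit.Base using (⊤)
open import Function.Bundles using (Injection)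
open import Induction.WellFounded using (Acc; acc; WellFounded)
open import Relation.Binary.Bundles using (Setoid)
open import Relation.Binary.PropositionalEquality.Core as ≡ using (_≡_)
open import Relation.Binary.PropositionalEquality.Properties using (setoid)
open import Relation.Nullary using (¬_; Dec; yes; no; contradiction)

------------------------------------------------------------------------
-- Ordinals

-- sup⁺ f denotes the least ordinal strictly above every f i.  Distinct
-- trees can denote the same ordinal, so equality of ordinals is _≈_.
data On : Set₁ where
  sup⁺ : {I : Set} → (I → On) → On

infix 4 _≤_ _<_ _≈_ _≉_

data _≤_ : On → On → Set₁
data _<_ : On → On → Set₁

data _≤_ where
  sup≤ : ∀ {I} {f : I → On} {β} → (∀ i → f i < β) → sup⁺ f ≤ β

data _<_ where
  <sup : ∀ {J} {g : J → On} {α} (j : J) → α ≤ g j → α < sup⁺ g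

_≈_ : On → On → Set₁
α ≈ β = α ≤ β × β ≤ α

_≉_ : On → On → Set₁
α ≉ β = ¬ (α ≈ β)

≤-refl : ∀ {α} → α ≤ α
≤-refl {sup⁺ f} = sup≤ λ i → <sup i ≤-refl

≤-trans : ∀ {α β γ} → α ≤ β → β ≤ γ → α ≤ γ
<-≤-trans : ∀ {α β γ} → α < β → β ≤ γ → α < γ
≤-<-trans : ∀ {α β γ} → α ≤ β → β < γ → α < γ

≤-trans (sup≤ p) q = sup≤ λ i → <-≤-trans (p i) q
<-≤-trans (<sup j p) (sup≤ q) = ≤-<-trans p (q j)
≤-<-trans p (<sup j q) = <sup j (≤-trans p q)

<⇒≤ : ∀ {α β} → α < β → α ≤ β
<⇒≤ (<sup j (sup≤ p)) = sup≤ λ i → <sup j (<⇒≤ (p i))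

<-irrefl : ∀ {α} → ¬ (α < α)
<-irrefl (<sup j (sup≤ p)) = <-irrefl (p j)

<-wellFounded : WellFounded _<_
<-wellFounded (sup⁺ f) = acc λ { (<sup j p) → down p (<-wellFounded (f j)) }
  where
  down : ∀ {α β} → α ≤ β → Acc _<_ β → Acc _<_ α
  down p (acc rs) = acc λ γ<α → rs (<-≤-trans γ<α p)

≈-refl : ∀ {α} → α ≈ α
≈-refl = ≤-refl , ≤-refl

≈-sym : ∀ {α β} → α ≈ β → β ≈ α
≈-sym (p , q) = q , p

≈-trans : ∀ {α β γ} → α ≈ β → β ≈ γ → α ≈ γ
≈-trans (p , q) (r , s) = ≤-trans p r , ≤-trans s q

-- The ordinal α as the set of smaller ordinals.
Below : On → Setoid (lsuc 0ℓ) (lsuc 0ℓ)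
Below α = record
  { Carrier       = Σ[ β ∈ On ] β < α
  ; _≈_           = λ x y → proj₁ x ≈ proj₁ y
  ; isEquivalence = record { refl = ≈-refl ; sym = ≈-sym ; trans = ≈-trans }
  }

0ᵒ : On
0ᵒ = sup⁺ {⊥} λ ()

1ᵒ : On
1ᵒ = sup⁺ {⊤} λ _ → 0ᵒ

Countable : On → Set₁
Countable α = Injection (Below α) (setoid ℕ)

Uncountable : On → Set₁
Uncountable α = ¬ Countable α

-- The proper subtrees of α.  By <⇒Pred below, they are representatives
-- of all the ordinals smaller than α, indexed by a small type.
Pred : On → Set
Pred (sup⁺ {I} f) = Σ[ i ∈ I ] Maybe (Pred (f i))

pred : ∀ α → Pred α → On
pred (sup⁺ f) (i , nothing) = f i
pred (sup⁺ f) (i , just p)  = pred (f i) p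

pred< : ∀ α (p : Pred α) → pred α p < α
pred< (sup⁺ f) (i , nothing) = <sup i ≤-refl
pred< (sup⁺ f) (i , just p)  = <sup i (<⇒≤ (pred< (f i) p))

IsLeast : (On → Set₁) → On → Set₁
IsLeast P α = P α × (∀ β → P β → α ≤ β)

------------------------------------------------------------------------
-- Fields

record IsField {c ℓ} (R : CommutativeRing c ℓ) : Set (c ⊔ ℓ) where
  open CommutativeRing R using (Carrier; _*_; 0#; 1#)
    renaming (_≈_ to _≈ᴿ_)
  field
    1≉0     : ¬ (1# ≈ᴿ 0#)
    inverse : ∀ x → ¬ (x ≈ᴿ 0#) → ∃[ y ] (x * y) ≈ᴿ 1#

-- a lists the coefficients of a polynomial of degree suc n.
IsAlgebraicallyClosed : ∀ {c ℓ} → CommutativeRing c ℓ → Set (c ⊔ ℓ)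
IsAlgebraicallyClosed R =
  ∀ n (a : Fin (suc (suc n)) → Carrier) → ¬ (a (fromℕ (suc n)) ≈ᴿ 0#) →
  ∃[ x ] sum (λ i → a i * x ^ toℕ i) ≈ᴿ 0#
  where
  open CommutativeRing R using (Carrier; _*_; 0#; +-monoid; semiring)
    renaming (_≈_ to _≈ᴿ_)
  open MonoidSum +-monoid using (sum)
  open SemiringExp semiring using (_^_)

------------------------------------------------------------------------
-- Nim arithmetic and ω₁

-- Classical logic is a parameter.  As it decides arbitrary types, not
-- only propositions, it also yields choice: Σ-types carry witnesses.
module Classical (em : ExcludedMiddle (lsuc 0ℓ)) where

  ≮⇒≥ : ∀ α β → ¬ (α < β) → β ≤ α
  ≮⇒≥ α (sup⁺ g) α≮β = sup≤ below
    where
    below : ∀ j → g j < α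
    below j with em {g j < α}
    ... | yes gj<α = gj<α
    ... | no  gj≮α = contradiction (<sup j (≮⇒≥ (g j) α gj≮α)) α≮β

  <⇒Pred : ∀ {α β} → β < α → ∃[ p ] β ≈ pred α p
  <⇒Pred {sup⁺ f} {β} (<sup i β≤fi) with em {β < f i}
  ... | no  β≮fi = (i , nothing) , β≤fi , ≮⇒≥ β (f i) β≮fi
  ... | yes β<fi with <⇒Pred β<fi
  ...   | p , β≈ = (i , just p) , β≈

  least : (P : On → Set₁) → ∃ P → ∃ (IsLeast P)
  least P (α , Pα) = search α Pα (<-wellFounded α)
    where
    search : ∀ α → P α → Acc _<_ α → ∃ (IsLeast P)
    search α Pα (acc rs) with em {∃[ β ] (β < α × P β)}
    ... | yes (β , β<α , Pβ) = search β Pβ (rs β<α)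
    ... | no  none           =
      α , Pα , λ β Pβ → ≮⇒≥ β α λ β<α → none (β , β<α , Pβ)

  -- The set S is given as the range of a family g.
  mex-least : {I : Set} (g : I → On) → ∃ (IsLeast λ γ → ∀ i → γ ≉ g i)
  mex-least g = least _ (sup⁺ g , λ i (sup≤gi , _) →
    <-irrefl (<-≤-trans (<sup i ≤-refl) sup≤gi))

  mex : {I : Set} → (I → On) → On
  mex g = proj₁ (mex-least g)

  mex-mono : ∀ {I J : Set} {g : I → On} {h : J → On} →
             (∀ i → ∃[ j ] g i ≈ h j) → mex g ≤ mex h
  mex-mono {g = g} {h} sub with mex-least g | mex-least h
  ... | _ , _ , lower | m , m∉h , _ =
    lower m λ i m≈gi → let (j , gi≈hj) = sub i in m∉h j (≈-trans m≈gi gi≈hj)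

  mex-cong : ∀ {I J : Set} {g : I → On} {h : J → On} →
             (∀ i → ∃[ j ] g i ≈ h j) → (∀ j → ∃[ i ] g i ≈ h j) →
             mex g ≈ mex h
  mex-cong sub sup =
    mex-mono sub , mex-mono λ j → let (i , eq) = sup j in i , ≈-sym eq

  ≈-Pred : ∀ {α α′} → α ≈ α′ → ∀ p → ∃[ p′ ] pred α p ≈ pred α′ p′
  ≈-Pred {α} (α≤α′ , _) p = <⇒Pred (<-≤-trans (pred< α p) α≤α′)

  ≈-Pred⁻ : ∀ {α α′} → α ≈ α′ → ∀ p′ → ∃[ p ] pred α p ≈ pred α′ p′
  ≈-Pred⁻ eq p′ = let (p , eq′) = ≈-Pred (≈-sym eq) p′ in p , ≈-sym eq′

  nimSum : ∀ α β → Acc _<_ α → Acc _<_ β → On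
  nimSum α β (acc r) (acc s) = mex {Pred α ⊎ Pred β}
    [ (λ p → nimSum (pred α p) β (r (pred< α p)) (acc s))
    , (λ q → nimSum α (pred β q) (acc r) (s (pred< β q)))
    ]

  infixl 6 _⊕_
  _⊕_ : Op₂ On
  α ⊕ β = nimSum α β (<-wellFounded α) (<-wellFounded β)

  nimSum-cong : ∀ {α α′ β β′} (a : Acc _<_ α) (b : Acc _<_ β) a′ b′ →
                α ≈ α′ → β ≈ β′ → nimSum α β a b ≈ nimSum α′ β′ a′ b′
  nimSum-cong (acc r) (acc s) (acc r′) (acc s′) α≈ β≈ = mex-cong
    (λ { (inj₁ p) → let (p′ , eq) = ≈-Pred α≈ p in
                    inj₁ p′ , nimSum-cong (r _) (acc s) (r′ _) (acc s′) eq β≈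
       ; (inj₂ q) → let (q′ , eq) = ≈-Pred β≈ q in
                    inj₂ q′ , nimSum-cong (acc r) (s _) (acc r′) (s′ _) α≈ eq })
    (λ { (inj₁ p′) → let (p , eq) = ≈-Pred⁻ α≈ p′ in
                     inj₁ p , nimSum-cong (r _) (acc s) (r′ _) (acc s′) eq β≈
       ; (inj₂ q′) → let (q , eq) = ≈-Pred⁻ β≈ q′ in
                     inj₂ q , nimSum-cong (acc r) (s _) (acc r′) (s′ _) α≈ eq })

  nimSum≈⊕ : ∀ {α α′ β β′} (a : Acc _<_ α) (b : Acc _<_ β) →
             α ≈ α′ → β ≈ β′ → nimSum α β a b ≈ α′ ⊕ β′
  nimSum≈⊕ a b = nimSum-cong a b (<-wellFounded _) (<-wellFounded _)

  ⊕-cong : ∀ {α α′ β β′} → α ≈ α′ → β ≈ β′ → α ⊕ β ≈ α′ ⊕ β′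
  ⊕-cong = nimSum≈⊕ (<-wellFounded _) (<-wellFounded _)

  -- The recursion for ⊕, with α′ and β′ ranging over all smaller ordinals.
  ⊕-mex : ∀ α β →
    IsLeast (λ γ → (∀ α′ → α′ < α → γ ≉ α′ ⊕ β)
                 × (∀ β′ → β′ < β → γ ≉ α ⊕ β′)) (α ⊕ β)
  ⊕-mex α β = go (<-wellFounded α) (<-wellFounded β)
    where
    go : ∀ a b → IsLeast (λ γ → (∀ α′ → α′ < α → γ ≉ α′ ⊕ β)
                              × (∀ β′ → β′ < β → γ ≉ α ⊕ β′)) (nimSum α β a b)
    go (acc r) (acc s) = let (m∉ , lower) = proj₂ (mex-least _) in
      ( (λ α′ α′<α m≈ → let (p , eq) = <⇒Pred α′<α in
          m∉ (inj₁ p) (≈-trans m≈ (≈-sym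
            (nimSum≈⊕ (r (pred< α p)) (acc s) (≈-sym eq) ≈-refl))))
      , (λ β′ β′<β m≈ → let (q , eq) = <⇒Pred β′<β in
          m∉ (inj₂ q) (≈-trans m≈ (≈-sym
            (nimSum≈⊕ (acc r) (s (pred< β q)) ≈-refl (≈-sym eq))))))
      , λ γ (γ∉₁ , γ∉₂) → lower γ
          λ { (inj₁ p) γ≈ → γ∉₁ _ (pred< α p) (≈-trans γ≈
                (nimSum≈⊕ (r (pred< α p)) (acc s) ≈-refl ≈-refl))
            ; (inj₂ q) γ≈ → γ∉₂ _ (pred< β q) (≈-trans γ≈
                (nimSum≈⊕ (acc r) (s (pred< β q)) ≈-refl ≈-refl)) }

  nimProduct : ∀ α β → Acc _<_ α → Acc _<_ β → On
  nimProduct α β (acc r) (acc s) = mex {Pred α × Pred β} λ (p , q) →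
      nimProduct (pred α p) β (r (pred< α p)) (acc s)
    ⊕ nimProduct α (pred β q) (acc r) (s (pred< β q))
    ⊕ nimProduct (pred α p) (pred β q) (r (pred< α p)) (s (pred< β q))

  infixl 7 _⊗_
  _⊗_ : Op₂ On
  α ⊗ β = nimProduct α β (<-wellFounded α) (<-wellFounded β)

  nimProduct-cong : ∀ {α α′ β β′} (a : Acc _<_ α) (b : Acc _<_ β) a′ b′ →
                    α ≈ α′ → β ≈ β′ →
                    nimProduct α β a b ≈ nimProduct α′ β′ a′ b′
  nimProduct-cong (acc r) (acc s) (acc r′) (acc s′) α≈ β≈ = mex-cong
    (λ (p , q) → let (p′ , eqp) = ≈-Pred α≈ p ; (q′ , eqq) = ≈-Pred β≈ q in
      (p′ , q′) , ⊕-cong (⊕-cong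
        (nimProduct-cong (r _) (acc s) (r′ _) (acc s′) eqp β≈)
        (nimProduct-cong (acc r) (s _) (acc r′) (s′ _) α≈ eqq))
        (nimProduct-cong (r _) (s _) (r′ _) (s′ _) eqp eqq))
    (λ (p′ , q′) → let (p , eqp) = ≈-Pred⁻ α≈ p′ ; (q , eqq) = ≈-Pred⁻ β≈ q′ in
      (p , q) , ⊕-cong (⊕-cong
        (nimProduct-cong (r _) (acc s) (r′ _) (acc s′) eqp β≈)
        (nimProduct-cong (acc r) (s _) (acc r′) (s′ _) α≈ eqq))
        (nimProduct-cong (r _) (s _) (r′ _) (s′ _) eqp eqq))

  nimProduct≈⊗ : ∀ {α α′ β β′} (a : Acc _<_ α) (b : Acc _<_ β) →
                 α ≈ α′ → β ≈ β′ → nimProduct α β a b ≈ α′ ⊗ β′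
  nimProduct≈⊗ a b = nimProduct-cong a b (<-wellFounded _) (<-wellFounded _)

  ⊗-cong : ∀ {α α′ β β′} → α ≈ α′ → β ≈ β′ → α ⊗ β ≈ α′ ⊗ β′
  ⊗-cong = nimProduct≈⊗ (<-wellFounded _) (<-wellFounded _)

  -- The recursion for ⊗, with α′ and β′ ranging over all smaller ordinals.
  ⊗-mex : ∀ α β →
    IsLeast (λ γ → ∀ α′ β′ → α′ < α → β′ < β →
                   γ ≉ (α′ ⊗ β) ⊕ (α ⊗ β′) ⊕ (α′ ⊗ β′)) (α ⊗ β)
  ⊗-mex α β = go (<-wellFounded α) (<-wellFounded β)
    where
    go : ∀ a b → IsLeast (λ γ → ∀ α′ β′ → α′ < α → β′ < β →
                   γ ≉ (α′ ⊗ β) ⊕ (α ⊗ β′) ⊕ (α′ ⊗ β′)) (nimProduct α β a b)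
    go (acc r) (acc s) =
      (λ α′ β′ α′<α β′<β m≈ →
        let (p , eqp) = <⇒Pred α′<α ; (q , eqq) = <⇒Pred β′<β in
        m∉ (p , q) (≈-trans m≈ (≈-sym (terms p q (≈-sym eqp) (≈-sym eqq)))))
      , λ γ γ∉ → lower γ λ (p , q) γ≈ →
          γ∉ _ _ (pred< α p) (pred< β q) (≈-trans γ≈ (terms p q ≈-refl ≈-refl))
      where
      g : Pred α × Pred β → On
      g (p , q) =
          nimProduct (pred α p) β (r (pred< α p)) (acc s)
        ⊕ nimProduct α (pred β q) (acc r) (s (pred< β q))
        ⊕ nimProduct (pred α p) (pred β q) (r (pred< α p)) (s (pred< β q))

      m∉ = proj₁ (proj₂ (mex-least g))
      lower = proj₂ (proj₂ (mex-least g))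

      terms : ∀ p q {α′ β′} → pred α p ≈ α′ → pred β q ≈ β′ →
              g (p , q) ≈ (α′ ⊗ β) ⊕ (α ⊗ β′) ⊕ (α′ ⊗ β′)
      terms p q eqp eqq = ⊕-cong (⊕-cong
        (nimProduct≈⊗ (r (pred< α p)) (acc s) eqp ≈-refl)
        (nimProduct≈⊗ (acc r) (s (pred< β q)) ≈-refl eqq))
        (nimProduct≈⊗ (r (pred< α p)) (s (pred< β q)) eqp eqq)

  record IsTranscendental (α : On) : Set₁ where
    field
      0<       : 0ᵒ < α
      1<       : 1ᵒ < α
      ⊕-closed : ∀ {β γ} → β < α → γ < α → β ⊕ γ < α
      ⊗-closed : ∀ {β γ} → β < α → γ < α → β ⊗ γ < α

    open Setoid (Below α) using (Carrier) renaming (_≈_ to _≈ᴮ_)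

    _+_ : Op₂ Carrier
    (β , β<) + (γ , γ<) = β ⊕ γ , ⊕-closed β< γ<

    _*_ : Op₂ Carrier
    (β , β<) * (γ , γ<) = β ⊗ γ , ⊗-closed β< γ<

    field
      -_                : Op₁ Carrier
      isCommutativeRing : IsCommutativeRing _≈ᴮ_ _+_ _*_ -_ (0ᵒ , 0<) (1ᵒ , 1<)

    commutativeRing : CommutativeRing (lsuc 0ℓ) (lsuc 0ℓ)
    commutativeRing = record { isCommutativeRing = isCommutativeRing }

    field
      isField               : IsField commutativeRing
      isAlgebraicallyClosed : IsAlgebraicallyClosed commutativeRing

  -- A witness that uncountable ordinals exist: the least ordinal above
  -- the values of all countably branching trees.
  data Tree : Set where
    leaf : Tree
    node : (ℕ → Tree) → Tree

  ⟦_⟧ : Tree → On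
  ⟦ leaf ⟧   = 0ᵒ
  ⟦ node t ⟧ = sup⁺ λ n → ⟦ t n ⟧

  trees-uncountable : Uncountable (sup⁺ ⟦_⟧)
  trees-uncountable inj =
    <-irrefl (≤-<-trans (bound x) (<sup (code x) ≤-refl))
    where
    open Injection inj renaming (to to code)
    open Setoid (Below (sup⁺ ⟦_⟧)) using (Carrier)

    tree : Carrier → Tree
    tree (_ , <sup t _) = t

    ≤tree : ∀ x → proj₁ x ≤ ⟦ tree x ⟧
    ≤tree (_ , <sup _ p) = p

    choose : ∀ n → Dec (∃[ x ] code x ≡ n) → Tree
    choose n (yes (x , _)) = tree x
    choose n (no _)        = leaf

    enum : ℕ → Tree
    enum n = choose n em

    bound : ∀ x → proj₁ x ≤ ⟦ enum (code x) ⟧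
    bound x with em {∃[ y ] code y ≡ code x}
    ... | yes (y , eq) = ≤-trans (proj₂ (injective {y} {x} eq)) (≤tree y)
    ... | no  none     = contradiction (x , ≡.refl) none

    x : Carrier
    x = ⟦ node enum ⟧ , <sup (node enum) ≤-refl

  ω₁-least : ∃ (IsLeast Uncountable)
  ω₁-least = least Uncountable (sup⁺ ⟦_⟧ , trees-uncountable)

  ω₁ : On
  ω₁ = proj₁ ω₁-least

{-# OPTIONS --safe #-}

-- Let Δ be a countable ordinal closed under ⊕ and ⊗ such that every
-- polynomial over Δ with a root in ω₁ has a root in Δ.  Dividing by linear
-- factors, Δ (as an element of ω₁) is transcendental over Δ (as a subset).
-- Let F = a + x G be a polynomial over Δ with G ≠ 0, so that F(Δ) ≠ 0 and
-- hence 0 < a ⊕ Δ ⊗ G(Δ).  The recursions for ⊕ and ⊗ say how 0 arises as an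
-- option of this ordinal: either 0 = a′ ⊕ Δ ⊗ G(Δ) with a′ < a, which
-- contradicts transcendence, or 0 = F(Δ) ⊕ (Δ ⊕ d) ⊗ (G(Δ) ⊕ v) with d < Δ and
-- v < G(Δ).  The same analysis shows that Δ[Δ] is an initial segment of the
-- ordinals, so v = H(Δ) with H over Δ.  By transcendence
-- F + (x + d)(G + H) = 0 as a polynomial, and x = d gives F(d) = 0.  As F need
-- not be monic, the case of degree 1 also yields inverses.
-- Countable ordinals Δ with these closure properties exist above any
-- countable ordinal because countable suprema of countable ordinals are
-- countable.

module Submission where

open import Defs
open import Level using (0ℓ) renaming (suc to lsuc)
open import Axiom.ExcludedMiddle using (ExcludedMiddle)
open import Algebra.Bundles using (AbelianGroup; CommutativeRing; RawRing)
open import Algebra.Core using (Op₂)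
import Algebra.Morphism.RingMonomorphism as RingMonomorphism
open import Algebra.Morphism.Structures using (IsRingHomomorphism; IsRingMonomorphism)
import Algebra.Properties.CommutativeSemigroup as CommutativeSemigroupProperties
import Algebra.Properties.Semiring.Exp as SemiringExp
import Algebra.Properties.Semiring.Sum as SemiringSum
import Algebra.Solver.CommutativeMonoid as CommutativeMonoidSolver
import Algebra.Solver.Ring as RingSolver
open import Algebra.Solver.Ring.AlmostCommutativeRing
  using (fromCommutativeRing; _-Raw-AlmostCommutative⟶_)
open import Algebra.Structures using (IsCommutativeRing)
open import Data.Bool.Base using (Bool; true; false; if_then_else_)
open import Data.Bool.Properties using (xor-∧-commutativeRing; _≟_)
open import Data.Fin.Base using (Fin; toℕ; fromℕ; zero; suc)
open import Data.Maybe.Base as Maybe using (Maybe)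
import Data.Nat.Base as ℕ
open import Data.Nat.Base using (ℕ; zero; suc)
import Data.Nat.Induction as ℕ
import Data.Nat.Properties as ℕ
open import Data.Product.Base using (∃; ∃-syntax; _×_; _,_; proj₁; proj₂)
open import Data.Sum.Base using (_⊎_; inj₁; inj₂; [_,_])
open import Data.Vec.Base using (Vec; []; _∷_; zipWith; foldr′; tabulate)
open import Data.Vec.Relation.Binary.Pointwise.Inductive using (Pointwise; []; _∷_)
open import Data.Vec.Relation.Unary.All as All using (All; []; _∷_)
open import Data.Vec.Relation.Unary.All.Properties using (tabulate⁺; tabulate⁻)
open import Function.Base using (id)
open import Function.Bundles using (Injection)
open import Induction.WellFounded using (Acc; acc)
open import Relation.Binary.Bundles using (Setoid)
open import Relation.Binary.Definitions using (Tri; tri<; tri≈; tri>)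
import Relation.Binary.PropositionalEquality.Core as ≡
open import Relation.Binary.PropositionalEquality.Core using (_≡_)
import Relation.Binary.Reasoning.Setoid as SetoidReasoning
open import Relation.Nullary using (¬_; Dec; yes; no; contradiction)
open import Relation.Nullary.Decidable.Core using (dec⇒maybe)

-- The order of ordinals

<⇒≉ : ∀ {α β} → α < β → α ≉ β
<⇒≉ α<β (_ , β≤α) = <-irrefl (<-≤-trans α<β β≤α)

<-respˡ-≈ : ∀ {α β γ} → α ≈ β → α < γ → β < γ
<-respˡ-≈ (_ , β≤α) α<γ = ≤-<-trans β≤α α<γ

<-trans : ∀ {α β γ} → α < β → β < γ → α < γ
<-trans α<β β<γ = <-≤-trans α<β (<⇒≤ β<γ)

≮0 : ∀ {α} → ¬ (α < 0ᵒ)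
≮0 (<sup () _)

<1⇒≈0 : ∀ {α} → α < 1ᵒ → α ≈ 0ᵒ
<1⇒≈0 (<sup _ α≤0) = α≤0 , sup≤ λ ()

0<1 : 0ᵒ < 1ᵒ
0<1 = <sup _ ≤-refl

On-setoid : Setoid (lsuc 0ℓ) (lsuc 0ℓ)
On-setoid = record
  { Carrier       = On
  ; _≈_           = _≈_
  ; isEquivalence = record { refl = ≈-refl ; sym = ≈-sym ; trans = ≈-trans }
  }

-- An interface hiding the definitions of ⊕ and ⊗: they unfold to expressions
-- from which α and β can no longer be inferred.
record NimArithmetic : Set₂ where
  infixl 6 _⊕_
  infixl 7 _⊗_
  field
    _⊕_    : Op₂ On
    _⊗_    : Op₂ On
    ⊕-cong : ∀ {α α′ β β′} → α ≈ α′ → β ≈ β′ → α ⊕ β ≈ α′ ⊕ β′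
    ⊗-cong : ∀ {α α′ β β′} → α ≈ α′ → β ≈ β′ → α ⊗ β ≈ α′ ⊗ β′
    ⊕-mex  : ∀ α β →
      IsLeast (λ γ → (∀ α′ → α′ < α → γ ≉ α′ ⊕ β)
                   × (∀ β′ → β′ < β → γ ≉ α ⊕ β′)) (α ⊕ β)
    ⊗-mex  : ∀ α β →
      IsLeast (λ γ → ∀ α′ β′ → α′ < α → β′ < β →
                     γ ≉ (α′ ⊗ β) ⊕ (α ⊗ β′) ⊕ (α′ ⊗ β′)) (α ⊗ β)

-- Countable ordinals: covers, suprema and closures

unpair : ℕ → ℕ × ℕ
unpair zero    = 0 , 0
unpair (suc n) with unpair n
... | a , zero  = 0 , suc a
... | a , suc b = suc a , b

-- `unpair` runs through each antidiagonal a + b = s from (0, s) to (s, 0). The induction is on s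
-- and, inside it, on a: the pair before (0, suc b) is the end (b, 0) of the previous antidiagonal.
unpair-surjective : ∀ a b → ∃[ n ] unpair n ≡ (a , b)
unpair-surjective a b = go (a ℕ.+ b) a b ≡.refl
  where
  next : ∀ {a b} n → unpair n ≡ (a , suc b) → unpair (suc n) ≡ (suc a , b)
  next n eq rewrite eq = ≡.refl

  wrap : ∀ {a} n → unpair n ≡ (a , 0) → unpair (suc n) ≡ (0 , suc a)
  wrap n eq rewrite eq = ≡.refl

  go : ∀ s a b → a ℕ.+ b ≡ s → ∃[ n ] unpair n ≡ (a , b)
  go _       zero    zero    _  = 0 , ≡.refl
  go (suc s) zero    (suc b) eq =
    let (n , eq′) = go s b 0 (≡.trans (ℕ.+-identityʳ b) (ℕ.suc-injective eq))
    in suc n , wrap n eq′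
  go s       (suc a) b       eq =
    let (n , eq′) = go s a (suc b) (≡.trans (ℕ.+-suc a b) eq)
    in suc n , next n eq′

module Countability (em : ExcludedMiddle (lsuc 0ℓ)) where

  -- The sequence may repeat values and leave α, so covers combine freely without any care for
  -- injectivity.
  Covers : (ℕ → On) → On → Set₁
  Covers e α = ∀ {β} → β < α → ∃[ n ] β ≈ e n

  leastℕ : (P : ℕ → Set₁) → ∃ P → ∃[ n ] P n × (∀ m → P m → n ℕ.≤ m)
  leastℕ P (n , Pn) = search n Pn (ℕ.<-wellFounded n)
    where
    search : ∀ n → P n → Acc ℕ._<_ n → ∃[ n ] P n × (∀ m → P m → n ℕ.≤ m)
    search n Pn (acc rs) with em {∃[ m ] m ℕ.< n × P m}
    ... | yes (m , m<n , Pm) = search m Pm (rs m<n)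
    ... | no  none           = n , Pn , λ m Pm → ℕ.≮⇒≥ λ m<n → none (m , m<n , Pm)

  -- Coding an ordinal by its least index makes the code depend only on its `≈`-class, as `cong`
  -- demands.
  covers⇒countable : ∀ {e α} → Covers e α → Countable α
  covers⇒countable {e} {α} cover = record
    { to        = λ x → proj₁ (code x)
    ; cong      = λ {x} {y} x≈y → ℕ.≤-antisym
        (proj₂ (proj₂ (code x)) _ (≈-trans x≈y (proj₁ (proj₂ (code y)))))
        (proj₂ (proj₂ (code y)) _ (≈-trans (≈-sym x≈y) (proj₁ (proj₂ (code x)))))
    ; injective = λ {x} {y} eq → ≈-trans (proj₁ (proj₂ (code x)))
        (≡.subst (λ n → e n ≈ proj₁ y) (≡.sym eq) (≈-sym (proj₁ (proj₂ (code y)))))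
    }
    where
    code : (x : Setoid.Carrier (Below α)) →
           ∃[ n ] proj₁ x ≈ e n × (∀ m → proj₁ x ≈ e m → n ℕ.≤ m)
    code (β , β<α) = leastℕ (λ n → β ≈ e n) (cover β<α)

  countable⇒covers : ∀ {α} → Countable α → ∃[ e ] (∀ n → e n ≤ α) × Covers e α
  countable⇒covers {α} inj = (λ n → value n em) , (λ n → value≤ n em) , cover
    where
    open Injection inj renaming (to to code)

    value : ∀ n → Dec (∃[ x ] code x ≡ n) → On
    value n (yes ((β , _) , _)) = β
    -- A default for numbers that code nothing. As α may itself be `0ᵒ`, the sequence is bounded
    -- only by `≤`.
    value n (no _)              = 0ᵒ

    value≤ : ∀ n d → value n d ≤ α
    value≤ n (yes ((_ , β<α) , _)) = <⇒≤ β<α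
    value≤ n (no _)                = sup≤ λ ()

    cover : Covers (λ n → value n em) α
    cover {β} β<α = code (β , β<α) , value≈ em
      where
      value≈ : ∀ d → β ≈ value (code (β , β<α)) d
      value≈ (yes (y , eq)) = ≈-sym (injective {y} {β , β<α} eq)
      value≈ (no none)      = contradiction ((β , β<α) , ≡.refl) none

  covers²⇒countable : ∀ {α} (g : ℕ → ℕ → On) →
    (∀ {β} → β < α → ∃[ m ] ∃[ n ] β ≈ g m n) → Countable α
  covers²⇒countable {α} g cover = covers⇒countable {e} λ β<α →
    let (m , n , β≈) = cover β<α
        (k , eq)     = unpair-surjective m n
    in k , ≡.subst (λ (m , n) → _ ≈ g m n) (≡.sym eq) β≈
    where
    e : ℕ → On
    e k = g (proj₁ (unpair k)) (proj₂ (unpair k))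

  module Least {ω₁ : On} (ω₁-least : IsLeast Uncountable ω₁) where

    open Classical em using (≮⇒≥)

    <ω₁⇒countable : ∀ {α} → α < ω₁ → Countable α
    <ω₁⇒countable {α} α<ω₁ with em {Countable α}
    ... | yes countable   = countable
    ... | no  uncountable = contradiction
      (<-≤-trans α<ω₁ (proj₂ ω₁-least α uncountable)) <-irrefl

    -- Otherwise ω₁ ≤ α, and the injection for α would restrict to one for ω₁.
    countable⇒<ω₁ : ∀ {α} → Countable α → α < ω₁
    countable⇒<ω₁ {α} inj with em {α < ω₁}
    ... | yes α<ω₁ = α<ω₁
    ... | no  α≮ω₁ = contradiction restricted (proj₁ ω₁-least)
      where
      open Injection inj using (to; cong; injective)

      weaken : Setoid.Carrier (Below ω₁) → Setoid.Carrier (Below α)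
      weaken (β , β<ω₁) = β , <-≤-trans β<ω₁ (≮⇒≥ α ω₁ α≮ω₁)

      restricted : Countable ω₁
      restricted = record
        { to        = λ x → to (weaken x)
        ; cong      = λ {x} {y} → cong {weaken x} {weaken y}
        ; injective = λ {x} {y} → injective {weaken x} {weaken y}
        }

    covers-<ω₁ : ∀ {α} → α < ω₁ → ∃[ e ] (∀ n → e n < ω₁) × Covers e α
    covers-<ω₁ α<ω₁ =
      let (e , e≤α , cover) = countable⇒covers (<ω₁⇒countable α<ω₁)
      in e , (λ n → ≤-<-trans (e≤α n) α<ω₁) , cover

    0<ω₁ : 0ᵒ < ω₁
    0<ω₁ = countable⇒<ω₁ (covers⇒countable {λ _ → 0ᵒ} λ β<0 → contradiction β<0 ≮0)

    1<ω₁ : 1ᵒ < ω₁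
    1<ω₁ = countable⇒<ω₁ (covers⇒countable {λ _ → 0ᵒ} λ β<1 → 0 , <1⇒≈0 β<1)

    -- An ordinal below the supremum is at most some `f n`. Row n of `g` therefore holds `f n` at
    -- index 0 and then a cover of `f n`.
    sup⁺-<ω₁ : (f : ℕ → On) → (∀ n → f n < ω₁) → sup⁺ f < ω₁
    sup⁺-<ω₁ f f<ω₁ = countable⇒<ω₁
      (covers²⇒countable g λ { (<sup n β≤fn) → cover n β≤fn })
      where
      g : ℕ → ℕ → On
      g n zero    = f n
      g n (suc m) = proj₁ (covers-<ω₁ (f<ω₁ n)) m

      cover : ∀ {β} n → β ≤ f n → ∃[ n ] ∃[ m ] β ≈ g n m
      cover {β} n β≤fn with em {β < f n}
      ... | no  β≮fn = n , 0 , β≤fn , ≮⇒≥ β (f n) β≮fn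
      ... | yes β<fn =
        let (m , β≈) = proj₂ (proj₂ (covers-<ω₁ (f<ω₁ n))) β<fn in n , suc m , β≈

    upperBound : ∀ {n} {as : Vec On n} → All (_< ω₁) as →
                 ∃[ β ] β < ω₁ × All (_< β) as
    upperBound []                         = 0ᵒ , 0<ω₁ , []
    upperBound {as = a ∷ _} (a<ω₁ ∷ as<ω₁) =
      let (β , β<ω₁ , as<β) = upperBound as<ω₁
          f = λ { zero → a ; (suc _) → β }
      in sup⁺ f , sup⁺-<ω₁ f (λ { zero → a<ω₁ ; (suc _) → β<ω₁ })
       , <sup 0 ≤-refl ∷ All.map (λ <β → <-trans <β (<sup 1 ≤-refl)) as<β

    -- A bound for `B` on all n-tuples of terms of `e`, as n nested countable suprema, so that
    -- tuples need not be enumerated.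
    supVec : ∀ n → (ℕ → On) → (Vec On n → On) → On
    supVec zero    e B = B []
    supVec (suc n) e B = sup⁺ λ i → supVec n e λ as → B (e i ∷ as)

    supVec-<ω₁ : ∀ n {e} {B : Vec On n → On} → (∀ i → e i < ω₁) →
                 (∀ as → All (_< ω₁) as → B as < ω₁) → supVec n e B < ω₁
    supVec-<ω₁ zero    e<ω₁ B<ω₁ = B<ω₁ [] []
    supVec-<ω₁ (suc n) e<ω₁ B<ω₁ = sup⁺-<ω₁ _ λ i → supVec-<ω₁ n e<ω₁ λ as as<ω₁ →
      B<ω₁ _ (e<ω₁ i ∷ as<ω₁)

    -- `B` is not assumed to respect `≈`, so the bound is for a tuple of terms of `e` that
    -- represents the given one.
    ≤supVec : ∀ {n e α} {B : Vec On n → On} {as : Vec On n} → Covers e α →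
              All (_< α) as → ∃[ bs ] Pointwise _≈_ as bs × B bs ≤ supVec n e B
    ≤supVec cover []             = [] , [] , ≤-refl
    ≤supVec cover (a<α ∷ as<α) =
      let (i , a≈)          = cover a<α
          (bs , as≈ , B≤) = ≤supVec cover as<α
      in _ , a≈ ∷ as≈ , <⇒≤ (<sup i B≤)

    -- A Löwenheim-Skolem construction: each stage bounds the values of all `F j` on tuples from the
    -- stage before, and ω stages suffice because a tuple is finite.
    module Closure (F : ∀ {n} → ℕ → Vec On n → On)
      (F<ω₁ : ∀ {n} j (as : Vec On n) → All (_< ω₁) as → F j as < ω₁)
      {α} (α<ω₁ : α < ω₁) where

      module Next {β} (β<ω₁ : β < ω₁) where

        e : ℕ → On
        e = proj₁ (covers-<ω₁ β<ω₁)

        row : ℕ → ℕ → On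
        row j n = supVec n e (F j)

        column : ℕ → On
        -- Index 0 is kept for β itself, which makes the stages increase; operation j moves to index
        -- `suc j`.
        column zero    = β
        column (suc j) = sup⁺ (row j)

        column<ω₁ : ∀ j → column j < ω₁
        column<ω₁ zero    = β<ω₁
        column<ω₁ (suc j) = sup⁺-<ω₁ (row j) λ n →
          supVec-<ω₁ n (proj₁ (proj₂ (covers-<ω₁ β<ω₁))) (F<ω₁ j)

        next : On
        next = sup⁺ column

        next<ω₁ : next < ω₁
        next<ω₁ = sup⁺-<ω₁ column column<ω₁

        β<next : β < next
        β<next = <sup 0 ≤-refl

        F<next : ∀ {n} j {as : Vec On n} → All (_< β) as →
                 ∃[ bs ] Pointwise _≈_ as bs × F j bs < next
        F<next {n} j as<β =
          let (bs , as≈bs , F≤) = ≤supVec (proj₂ (proj₂ (covers-<ω₁ β<ω₁))) as<β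
          in bs , as≈bs , <sup (suc j) (<⇒≤ (<sup n F≤))

      stage  : ℕ → On
      stage< : ∀ k → stage k < ω₁
      stage zero     = α
      stage (suc k)  = Next.next (stage< k)
      stage< zero    = α<ω₁
      stage< (suc k) = Next.next<ω₁ (stage< k)

      stage-mono : ∀ {k l} → k ℕ.≤′ l → stage k ≤ stage l
      stage-mono (ℕ.≤′-reflexive ≡.refl) = ≤-refl
      stage-mono (ℕ.≤′-step k≤l)         =
        ≤-trans (stage-mono k≤l) (<⇒≤ (Next.β<next (stage< _)))

      closure : On
      closure = sup⁺ stage

      closure<ω₁ : closure < ω₁
      closure<ω₁ = sup⁺-<ω₁ stage stage<

      α<closure : α < closure
      α<closure = <sup 0 ≤-refl

      reached : ∀ {n} {as : Vec On n} → All (_< closure) as → ∃[ k ] All (_< stage k) as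
      reached []                     = 0 , []
      reached (<sup k a≤ ∷ as<) =
        let (l , as<l) = reached as<
            -- The head is only known to be `≤ stage k`, so it lies strictly below the next stage;
            -- the maximum also accommodates the tail.
            m          = suc k ℕ.⊔ l
        in m , <-≤-trans (≤-<-trans a≤ (Next.β<next (stage< k)))
                         (stage-mono (ℕ.≤⇒≤′ (ℕ.m≤m⊔n (suc k) l)))
             ∷ All.map (λ <l → <-≤-trans <l (stage-mono (ℕ.≤⇒≤′ (ℕ.m≤n⊔m (suc k) l)))) as<l

      closed : ∀ {n} j {as : Vec On n} → All (_< closure) as →
               ∃[ bs ] Pointwise _≈_ as bs × F j bs < closure
      closed j as< =
        let (k , as<k)         = reached as<
            (bs , as≈bs , F<) = Next.F<next (stage< k) j as<k
        in bs , as≈bs , <-≤-trans F< (<⇒≤ (<sup (suc k) ≤-refl))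

-- The ring On₂, polynomials over it, and their roots

module NimField (em : ExcludedMiddle (lsuc 0ℓ)) (nim : NimArithmetic) where

  open NimArithmetic nim
  open Classical em using (≮⇒≥)
  open SetoidReasoning On-setoid

  <-cmp : ∀ α β → Tri (α < β) (α ≈ β) (β < α)
  <-cmp α β with em {α < β} | em {β < α}
  ... | yes α<β | _       =
    tri< α<β (<⇒≉ α<β) λ β<α → <-irrefl (<-trans α<β β<α)
  ... | no α≮β  | yes β<α = tri> α≮β (λ α≈β → <⇒≉ β<α (≈-sym α≈β)) β<α
  ... | no α≮β  | no β≮α  = tri≈ α≮β (≮⇒≥ β α β≮α , ≮⇒≥ α β α≮β) β≮α

  ≮∧≯⇒≈ : ∀ {α β} → ¬ (α < β) → ¬ (β < α) → α ≈ β
  ≮∧≯⇒≈ {α} {β} α≮β β≮α = ≮⇒≥ β α β≮α , ≮⇒≥ α β α≮β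

  0<⇐≉0 : ∀ {α} → α ≉ 0ᵒ → 0ᵒ < α
  0<⇐≉0 {α} α≉0 with <-cmp 0ᵒ α
  ... | tri< 0<α _ _ = 0<α
  ... | tri≈ _ 0≈α _ = contradiction (≈-sym 0≈α) α≉0
  ... | tri> _ _ α<0 = contradiction α<0 ≮0

  -- Nim addition

  ⊕-avoidˡ : ∀ {α α′ β} → α′ < α → α ⊕ β ≉ α′ ⊕ β
  ⊕-avoidˡ {α} {α′} {β} = proj₁ (proj₁ (⊕-mex α β)) α′

  ⊕-avoidʳ : ∀ {α β β′} → β′ < β → α ⊕ β ≉ α ⊕ β′
  ⊕-avoidʳ {α} {β} {β′} = proj₂ (proj₁ (⊕-mex α β)) β′

  -- The minimality half of the mex: an ordinal that is no option cannot lie below it.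
  ⊕-below : ∀ {α β ζ} → ζ < α ⊕ β →
            (∃[ α′ ] α′ < α × ζ ≈ α′ ⊕ β) ⊎ (∃[ β′ ] β′ < β × ζ ≈ α ⊕ β′)
  ⊕-below {α} {β} {ζ} ζ<
    with em {∃[ α′ ] α′ < α × ζ ≈ α′ ⊕ β} | em {∃[ β′ ] β′ < β × ζ ≈ α ⊕ β′}
  ... | yes left | _         = inj₁ left
  ... | no _     | yes right = inj₂ right
  ... | no ¬left | no ¬right = contradiction
    (<-≤-trans ζ< (proj₂ (⊕-mex α β) ζ
      ( (λ α′ α′<α ζ≈ → ¬left (α′ , α′<α , ζ≈))
      , (λ β′ β′<β ζ≈ → ¬right (β′ , β′<β , ζ≈)))))
    <-irrefl

  ⊕-cancelʳ : ∀ {α β γ} → α ⊕ γ ≈ β ⊕ γ → α ≈ β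
  ⊕-cancelʳ {α} {β} eq with <-cmp α β
  ... | tri< α<β _ _ = contradiction (≈-sym eq) (⊕-avoidˡ α<β)
  ... | tri≈ _ α≈β _ = α≈β
  ... | tri> _ _ β<α = contradiction eq (⊕-avoidˡ β<α)

  ⊕-cancelˡ : ∀ {α β γ} → γ ⊕ α ≈ γ ⊕ β → α ≈ β
  ⊕-cancelˡ {α} {β} eq with <-cmp α β
  ... | tri< α<β _ _ = contradiction (≈-sym eq) (⊕-avoidʳ α<β)
  ... | tri≈ _ α≈β _ = α≈β
  ... | tri> _ _ β<α = contradiction eq (⊕-avoidʳ β<α)

  ⊕-congˡ : ∀ {α β γ} → α ≈ β → γ ⊕ α ≈ γ ⊕ β
  ⊕-congˡ = ⊕-cong ≈-refl

  ⊕-congʳ : ∀ {α β γ} → α ≈ β → α ⊕ γ ≈ β ⊕ γ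
  ⊕-congʳ eq = ⊕-cong eq ≈-refl

  -- If one side were smaller, it would be an option of the other. The induction hypothesis turns it
  -- into an option of itself, which the mex excludes. Most laws below follow this pattern.
  ⊕-comm : ∀ α β → α ⊕ β ≈ β ⊕ α
  ⊕-comm α β = go (<-wellFounded α) (<-wellFounded β)
    where
    go : ∀ {α β} → Acc _<_ α → Acc _<_ β → α ⊕ β ≈ β ⊕ α
    go {α} {β} (acc r) (acc s) = ≮∧≯⇒≈
      (λ lt →
        [ (λ (β′ , β′<β , eq) →
            ⊕-avoidʳ β′<β (≈-trans eq (≈-sym (go (acc r) (s β′<β)))))
        , (λ (α′ , α′<α , eq) →
            ⊕-avoidˡ α′<α (≈-trans eq (≈-sym (go (r α′<α) (acc s)))))
        ] (⊕-below lt))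
      (λ lt →
        [ (λ (α′ , α′<α , eq) →
            ⊕-avoidʳ α′<α (≈-trans eq (go (r α′<α) (acc s))))
        , (λ (β′ , β′<β , eq) →
            ⊕-avoidˡ β′<β (≈-trans eq (go (acc r) (s β′<β))))
        ] (⊕-below lt))

  ⊕-assoc : ∀ α β γ → (α ⊕ β) ⊕ γ ≈ α ⊕ (β ⊕ γ)
  ⊕-assoc α β γ = go (<-wellFounded α) (<-wellFounded β) (<-wellFounded γ)
    where
    go : ∀ {α β γ} → Acc _<_ α → Acc _<_ β → Acc _<_ γ →
         (α ⊕ β) ⊕ γ ≈ α ⊕ (β ⊕ γ)
    go {α} {β} {γ} (acc r) (acc s) (acc t) = ≮∧≯⇒≈ left right
      where
      ihα : ∀ {α′} → α′ < α → (α′ ⊕ β) ⊕ γ ≈ α′ ⊕ (β ⊕ γ)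
      ihα α′<α = go (r α′<α) (acc s) (acc t)
      ihβ : ∀ {β′} → β′ < β → (α ⊕ β′) ⊕ γ ≈ α ⊕ (β′ ⊕ γ)
      ihβ β′<β = go (acc r) (s β′<β) (acc t)
      ihγ : ∀ {γ′} → γ′ < γ → (α ⊕ β) ⊕ γ′ ≈ α ⊕ (β ⊕ γ′)
      ihγ γ′<γ = go (acc r) (acc s) (t γ′<γ)

      left : ¬ ((α ⊕ β) ⊕ γ < α ⊕ (β ⊕ γ))
      left lt with ⊕-below lt
      ... | inj₁ (α′ , α′<α , eq) =
        ⊕-avoidˡ α′<α (⊕-cancelʳ (≈-trans eq (≈-sym (ihα α′<α))))
      ... | inj₂ (δ , δ< , eq) with ⊕-below δ<
      ...   | inj₁ (β′ , β′<β , eq′) = ⊕-avoidʳ β′<β (⊕-cancelʳ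
        (≈-trans eq (≈-trans (⊕-congˡ eq′) (≈-sym (ihβ β′<β)))))
      ...   | inj₂ (γ′ , γ′<γ , eq′) = ⊕-avoidʳ γ′<γ
        (≈-trans eq (≈-trans (⊕-congˡ eq′) (≈-sym (ihγ γ′<γ))))

      right : ¬ (α ⊕ (β ⊕ γ) < (α ⊕ β) ⊕ γ)
      right lt with ⊕-below lt
      ... | inj₂ (γ′ , γ′<γ , eq) =
        ⊕-avoidʳ γ′<γ (⊕-cancelˡ (≈-trans eq (ihγ γ′<γ)))
      ... | inj₁ (δ , δ< , eq) with ⊕-below δ<
      ...   | inj₁ (α′ , α′<α , eq′) = ⊕-avoidˡ α′<α
        (≈-trans eq (≈-trans (⊕-congʳ eq′) (ihα α′<α)))
      ...   | inj₂ (β′ , β′<β , eq′) = ⊕-avoidˡ β′<β (⊕-cancelˡ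
        (≈-trans eq (≈-trans (⊕-congʳ eq′) (ihβ β′<β))))

  ⊕-identityʳ : ∀ α → α ⊕ 0ᵒ ≈ α
  ⊕-identityʳ α = go (<-wellFounded α)
    where
    go : ∀ {α} → Acc _<_ α → α ⊕ 0ᵒ ≈ α
    go {α} (acc r) = ≮∧≯⇒≈
      -- Were `α ⊕ 0ᵒ` below α, the induction hypothesis for it and cancellation would give
      -- `α ⊕ 0ᵒ ≈ α`.
      (λ lt → <⇒≉ lt (⊕-cancelʳ (go (r lt))))
      (λ lt → [ (λ (α′ , α′<α , eq) → <⇒≉ α′<α (≈-sym (≈-trans eq (go (r α′<α)))))
              , (λ (_ , <0 , _) → ≮0 <0) ] (⊕-below lt))

  ⊕-self : ∀ α → α ⊕ α ≈ 0ᵒ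
  ⊕-self α = go (<-wellFounded α)
    where
    go : ∀ {α} → Acc _<_ α → α ⊕ α ≈ 0ᵒ
    go {α} (acc r) = ≮∧≯⇒≈ ≮0
      (λ lt → [ (λ (α′ , α′<α , eq) →
                  <⇒≉ α′<α (⊕-cancelˡ (≈-trans (go (r α′<α)) eq)))
              , (λ (α′ , α′<α , eq) →
                  <⇒≉ α′<α (⊕-cancelʳ (≈-trans (go (r α′<α)) eq)))
              ] (⊕-below lt))

  ⊕-identityˡ : ∀ α → 0ᵒ ⊕ α ≈ α
  ⊕-identityˡ α = ≈-trans (⊕-comm 0ᵒ α) (⊕-identityʳ α)

  ⊕-abelianGroup : AbelianGroup (lsuc 0ℓ) (lsuc 0ℓ)
  ⊕-abelianGroup = record
    { Carrier        = On
    ; _≈_            = _≈_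
    ; _∙_            = _⊕_
    ; ε              = 0ᵒ
    ; _⁻¹            = id
    ; isAbelianGroup = record
      { isGroup = record
        { isMonoid = record
          { isSemigroup = record
            { isMagma = record
              { isEquivalence = Setoid.isEquivalence On-setoid
              ; ∙-cong        = ⊕-cong
              }
            ; assoc = ⊕-assoc
            }
          ; identity = ⊕-identityˡ , ⊕-identityʳ
          }
        ; inverse = ⊕-self , ⊕-self
        ; ⁻¹-cong = id
        }
      ; comm = ⊕-comm
      }
    }

  open AbelianGroup ⊕-abelianGroup using (commutativeMonoid; commutativeSemigroup)
  open CommutativeSemigroupProperties commutativeSemigroup
    using (interchange)

  ⊕≈0⇒≈ : ∀ {α β} → α ⊕ β ≈ 0ᵒ → α ≈ β
  ⊕≈0⇒≈ eq = ⊕-cancelʳ (≈-trans eq (≈-sym (⊕-self _)))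

  ≈⇒⊕≈0 : ∀ {α β} → α ≈ β → α ⊕ β ≈ 0ᵒ
  ≈⇒⊕≈0 α≈β = ≈-trans (⊕-congʳ α≈β) (⊕-self _)

  -- Nim multiplication

  ⊗-avoid : ∀ {α β α′ β′} → α′ < α → β′ < β →
            α ⊗ β ≉ α′ ⊗ β ⊕ α ⊗ β′ ⊕ α′ ⊗ β′
  ⊗-avoid {α} {β} {α′} {β′} = proj₁ (⊗-mex α β) α′ β′

  ⊗-below : ∀ {α β ζ} → ζ < α ⊗ β → ∃[ α′ ] ∃[ β′ ]
            α′ < α × β′ < β × ζ ≈ α′ ⊗ β ⊕ α ⊗ β′ ⊕ α′ ⊗ β′
  ⊗-below {α} {β} {ζ} ζ<
    with em {∃[ α′ ] ∃[ β′ ] α′ < α × β′ < β × ζ ≈ α′ ⊗ β ⊕ α ⊗ β′ ⊕ α′ ⊗ β′}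
  ... | yes option = option
  ... | no ¬option = contradiction
    (<-≤-trans ζ< (proj₂ (⊗-mex α β) ζ λ α′ β′ α′<α β′<β ζ≈ →
      ¬option (α′ , β′ , α′<α , β′<β , ζ≈)))
    <-irrefl

  ⊗-congˡ : ∀ {α β γ} → α ≈ β → γ ⊗ α ≈ γ ⊗ β
  ⊗-congˡ = ⊗-cong ≈-refl

  ⊗-congʳ : ∀ {α β γ} → α ≈ β → α ⊗ γ ≈ β ⊗ γ
  ⊗-congʳ eq = ⊗-cong eq ≈-refl

  ⊗-comm : ∀ α β → α ⊗ β ≈ β ⊗ α
  ⊗-comm α β = go (<-wellFounded α) (<-wellFounded β)
    where
    go : ∀ {α β} → Acc _<_ α → Acc _<_ β → α ⊗ β ≈ β ⊗ α
    go {α} {β} (acc r) (acc s) = ≮∧≯⇒≈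
      (λ lt → let (β′ , α′ , β′<β , α′<α , eq) = ⊗-below lt in
        ⊗-avoid α′<α β′<β (≈-trans eq (≈-sym (options α′<α β′<β))))
      (λ lt → let (α′ , β′ , α′<α , β′<β , eq) = ⊗-below lt in
        ⊗-avoid β′<β α′<α (≈-trans eq (options α′<α β′<β)))
      where
      options : ∀ {α′ β′} → α′ < α → β′ < β →
                α′ ⊗ β ⊕ α ⊗ β′ ⊕ α′ ⊗ β′ ≈ β′ ⊗ α ⊕ β ⊗ α′ ⊕ β′ ⊗ α′
      options {α′} {β′} α′<α β′<β = ⊕-cong
        (≈-trans (⊕-comm _ _) (⊕-cong (go (acc r) (s β′<β)) (go (r α′<α) (acc s))))
        (go (r α′<α) (s β′<β))

  ⊗-zeroˡ : ∀ α → 0ᵒ ⊗ α ≈ 0ᵒ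
  ⊗-zeroˡ α = ≮∧≯⇒≈ ≮0 λ lt → let (_ , _ , <0 , _) = ⊗-below lt in ≮0 <0

  ⊗-zeroʳ : ∀ α → α ⊗ 0ᵒ ≈ 0ᵒ
  ⊗-zeroʳ α = ≈-trans (⊗-comm α 0ᵒ) (⊗-zeroˡ α)

  ⊗-identityˡ : ∀ α → 1ᵒ ⊗ α ≈ α
  ⊗-identityˡ α = go (<-wellFounded α)
    where
    go : ∀ {α} → Acc _<_ α → 1ᵒ ⊗ α ≈ α
    go {α} (acc r) = ≮∧≯⇒≈
      -- Were `1ᵒ ⊗ α` below α, the induction hypothesis for it would make it the option of `1ᵒ ⊗ α`
      -- at `0ᵒ` and `1ᵒ ⊗ α`.
      (λ lt → ⊗-avoid 0<1 lt (≈-trans (≈-sym (go (r lt))) (≈-sym (option ≈-refl))))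
      (λ lt → let (_ , α′ , <1 , α′<α , eq) = ⊗-below lt in
        <⇒≉ α′<α (≈-sym (≈-trans eq (≈-trans (option (<1⇒≈0 <1)) (go (r α′<α))))))
      where
      option : ∀ {ζ α′} → ζ ≈ 0ᵒ → ζ ⊗ α ⊕ 1ᵒ ⊗ α′ ⊕ ζ ⊗ α′ ≈ 1ᵒ ⊗ α′
      option {ζ} {α′} ζ≈0 = begin
        ζ ⊗ α ⊕ 1ᵒ ⊗ α′ ⊕ ζ ⊗ α′  ≈⟨ ⊕-cong (⊕-congʳ (vanish α)) (vanish α′) ⟩
        0ᵒ ⊕ 1ᵒ ⊗ α′ ⊕ 0ᵒ         ≈⟨ ⊕-identityʳ _ ⟩
        0ᵒ ⊕ 1ᵒ ⊗ α′              ≈⟨ ⊕-identityˡ _ ⟩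
        1ᵒ ⊗ α′                   ∎
        where
        vanish : ∀ β → ζ ⊗ β ≈ 0ᵒ
        vanish β = ≈-trans (⊗-congʳ ζ≈0) (⊗-zeroˡ β)

  ⊗-identityʳ : ∀ α → α ⊗ 1ᵒ ≈ α
  ⊗-identityʳ α = ≈-trans (⊗-comm α 1ᵒ) (⊗-identityˡ α)

  -- (α ⊕ α′) ⊗ (β ⊕ β′) multiplied out
  cross : On → On → On → On → On
  cross α α′ β β′ = (α ⊗ β ⊕ α′ ⊗ β) ⊕ (α ⊗ β′ ⊕ α′ ⊗ β′)

  option⇒cross≈0 : ∀ {α α′ β β′} →
    α ⊗ β ≈ α′ ⊗ β ⊕ α ⊗ β′ ⊕ α′ ⊗ β′ → cross α α′ β β′ ≈ 0ᵒ
  option⇒cross≈0 eq = ≈-trans (⊕-assoc _ _ _) (≈⇒⊕≈0 (≈-trans eq (⊕-assoc _ _ _)))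

  cross≈0⇒option : ∀ {α α′ β β′} →
    cross α α′ β β′ ≈ 0ᵒ → α ⊗ β ≈ α′ ⊗ β ⊕ α ⊗ β′ ⊕ α′ ⊗ β′
  cross≈0⇒option eq = ≈-trans (⊕≈0⇒≈ (≈-trans (≈-sym (⊕-assoc _ _ _)) eq))
                              (≈-sym (⊕-assoc _ _ _))

  cross≉0 : ∀ {α α′ β β′} → α ≉ α′ → β ≉ β′ → cross α α′ β β′ ≉ 0ᵒ
  cross≉0 {α} {α′} {β} {β′} α≉ β≉ eq with <-cmp α α′ | <-cmp β β′
  ... | tri≈ _ α≈ _ | _            = α≉ α≈
  ... | tri< _ _ _  | tri≈ _ β≈ _  = β≉ β≈
  ... | tri> _ _ _  | tri≈ _ β≈ _  = β≉ β≈
  ... | tri> _ _ α′< | tri> _ _ β′< = ⊗-avoid α′< β′< (cross≈0⇒option eq)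
  ... | tri> _ _ α′< | tri< β< _ _  = ⊗-avoid α′< β< (cross≈0⇒option
        (≈-trans (⊕-comm _ _) eq))
  ... | tri< α< _ _ | tri> _ _ β′<  = ⊗-avoid α< β′< (cross≈0⇒option
        (≈-trans (⊕-cong (⊕-comm _ _) (⊕-comm _ _)) eq))
  ... | tri< α< _ _ | tri< β< _ _   = ⊗-avoid α< β< (cross≈0⇒option
        (≈-trans (⊕-cong (⊕-comm _ _) (⊕-comm _ _)) (≈-trans (⊕-comm _ _) eq)))

  ⊗-distribʳ : ∀ γ α β → (α ⊕ β) ⊗ γ ≈ α ⊗ γ ⊕ β ⊗ γ
  ⊗-distribʳ γ α β = go (<-wellFounded α) (<-wellFounded β) (<-wellFounded γ)
    where
    Distributes : On → On → On → Set₁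
    Distributes α β γ = (α ⊕ β) ⊗ γ ≈ α ⊗ γ ⊕ β ⊗ γ

    swap : ∀ {α β γ} → Distributes α β γ → Distributes β α γ
    swap d = ≈-trans (⊗-congʳ (⊕-comm _ _)) (≈-trans d (⊕-comm _ _))

    module _ {α β γ α′ γ′} (α′<α : α′ < α) (γ′<γ : γ′ < γ)
             (d₁ : Distributes α′ β γ) (d₂ : Distributes α β γ′)
             (d₃ : Distributes α′ β γ′) where

      -- After expansion by the induction hypotheses, the two terms `β ⊗ γ′` cancel.
      options : (α′ ⊕ β) ⊗ γ ⊕ (α ⊕ β) ⊗ γ′ ⊕ (α′ ⊕ β) ⊗ γ′ ≈
                (α′ ⊗ γ ⊕ α ⊗ γ′ ⊕ α′ ⊗ γ′) ⊕ β ⊗ γ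
      options = begin
        (α′ ⊕ β) ⊗ γ ⊕ (α ⊕ β) ⊗ γ′ ⊕ (α′ ⊕ β) ⊗ γ′
          ≈⟨ ⊕-cong (⊕-cong d₁ d₂) d₃ ⟩
        (α′ ⊗ γ ⊕ β ⊗ γ) ⊕ (α ⊗ γ′ ⊕ β ⊗ γ′) ⊕ (α′ ⊗ γ′ ⊕ β ⊗ γ′)
          ≈⟨ solve 5 (λ p q r s t →
               (((p ∙ q) ∙ (r ∙ s)) ∙ (t ∙ s)) ⊜ ((((p ∙ r) ∙ t) ∙ q) ∙ (s ∙ s)))
               ≈-refl _ _ _ _ _ ⟩
        (α′ ⊗ γ ⊕ α ⊗ γ′ ⊕ α′ ⊗ γ′) ⊕ β ⊗ γ ⊕ (β ⊗ γ′ ⊕ β ⊗ γ′)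
          ≈⟨ ⊕-congˡ (⊕-self _) ⟩
        (α′ ⊗ γ ⊕ α ⊗ γ′ ⊕ α′ ⊗ γ′) ⊕ β ⊗ γ ⊕ 0ᵒ
          ≈⟨ ⊕-identityʳ _ ⟩
        (α′ ⊗ γ ⊕ α ⊗ γ′ ⊕ α′ ⊗ γ′) ⊕ β ⊗ γ ∎
        where open CommutativeMonoidSolver commutativeMonoid
                using (solve; _⊜_) renaming (_⊕_ to _∙_)

      -- `α′ ⊕ β` differs from `α ⊕ β` but need not be smaller, so `cross≉0` takes the place of
      -- `⊗-avoid`.
      ≉-optionˡ : (α ⊕ β) ⊗ γ ≉ (α′ ⊗ γ ⊕ α ⊗ γ′ ⊕ α′ ⊗ γ′) ⊕ β ⊗ γ
      ≉-optionˡ eq = cross≉0 (⊕-avoidˡ α′<α) (λ γ≈ → <⇒≉ γ′<γ (≈-sym γ≈))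
        (option⇒cross≈0 (≈-trans eq (≈-sym options)))

      ≉-optionʳ : α ⊗ γ ⊕ β ⊗ γ ≉
                  (α′ ⊕ β) ⊗ γ ⊕ (α ⊕ β) ⊗ γ′ ⊕ (α′ ⊕ β) ⊗ γ′
      ≉-optionʳ eq = ⊗-avoid α′<α γ′<γ (⊕-cancelʳ (≈-trans eq options))

    go : ∀ {α β γ} → Acc _<_ α → Acc _<_ β → Acc _<_ γ → Distributes α β γ
    go {α} {β} {γ} (acc r) (acc s) (acc t) = ≮∧≯⇒≈ left right
      where
      left : ¬ ((α ⊕ β) ⊗ γ < α ⊗ γ ⊕ β ⊗ γ)
      left lt with ⊕-below lt
      ... | inj₁ (_ , δ< , eq) =
        let (α′ , γ′ , α′<α , γ′<γ , eq′) = ⊗-below δ< in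
        ≉-optionˡ α′<α γ′<γ (go (r α′<α) (acc s) (acc t))
          (go (acc r) (acc s) (t γ′<γ)) (go (r α′<α) (acc s) (t γ′<γ))
          (≈-trans eq (⊕-congʳ eq′))
      ... | inj₂ (_ , δ< , eq) =
        let (β′ , γ′ , β′<β , γ′<γ , eq′) = ⊗-below δ< in
        ≉-optionˡ β′<β γ′<γ (swap (go (acc r) (s β′<β) (acc t)))
          (swap (go (acc r) (acc s) (t γ′<γ))) (swap (go (acc r) (s β′<β) (t γ′<γ)))
          (≈-trans (⊗-congʳ (⊕-comm β α))
            (≈-trans eq (≈-trans (⊕-congˡ eq′) (⊕-comm _ _))))

      right : ¬ (α ⊗ γ ⊕ β ⊗ γ < (α ⊕ β) ⊗ γ)
      right lt with ⊗-below lt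
      ... | δ , γ′ , δ< , γ′<γ , eq with ⊕-below δ<
      ...   | inj₁ (α′ , α′<α , δ≈) =
        ≉-optionʳ α′<α γ′<γ (go (r α′<α) (acc s) (acc t))
          (go (acc r) (acc s) (t γ′<γ)) (go (r α′<α) (acc s) (t γ′<γ))
          (≈-trans eq (⊕-cong (⊕-congʳ (⊗-congʳ δ≈)) (⊗-congʳ δ≈)))
      ...   | inj₂ (β′ , β′<β , δ≈) =
        ≉-optionʳ β′<β γ′<γ (swap (go (acc r) (s β′<β) (acc t)))
          (swap (go (acc r) (acc s) (t γ′<γ))) (swap (go (acc r) (s β′<β) (t γ′<γ)))
          (≈-trans (⊕-comm _ _) (≈-trans eq (⊕-cong
            (⊕-cong (⊗-congʳ δ≈β′) (⊗-congʳ (⊕-comm α β))) (⊗-congʳ δ≈β′))))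
        where
        δ≈β′ : δ ≈ β′ ⊕ α
        δ≈β′ = ≈-trans δ≈ (⊕-comm α β′)

  ⊗-distribˡ : ∀ γ α β → γ ⊗ (α ⊕ β) ≈ γ ⊗ α ⊕ γ ⊗ β
  ⊗-distribˡ γ α β = ≈-trans (⊗-comm _ _)
    (≈-trans (⊗-distribʳ γ α β) (⊕-cong (⊗-comm _ _) (⊗-comm _ _)))

  cross≈⊗ : ∀ α α′ β β′ → cross α α′ β β′ ≈ (α ⊕ α′) ⊗ (β ⊕ β′)
  cross≈⊗ α α′ β β′ = ≈-sym (≈-trans (⊗-distribˡ _ _ _)
    (⊕-cong (⊗-distribʳ _ _ _) (⊗-distribʳ _ _ _)))

  -- Distributivity factors the difference between a product and its option.
  ⊗-below′ : ∀ {α β ζ} → ζ < α ⊗ β → ∃[ α′ ] ∃[ β′ ]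
             α′ < α × β′ < β × ζ ⊕ α ⊗ β ≈ (α ⊕ α′) ⊗ (β ⊕ β′)
  ⊗-below′ {α} {β} {ζ} ζ< with ⊗-below ζ<
  ... | α′ , β′ , α′<α , β′<β , eq = α′ , β′ , α′<α , β′<β , (begin
    ζ ⊕ α ⊗ β                                ≈⟨ ⊕-congʳ eq ⟩
    (α′ ⊗ β ⊕ α ⊗ β′ ⊕ α′ ⊗ β′) ⊕ α ⊗ β      ≈⟨ ⊕-comm _ _ ⟩
    α ⊗ β ⊕ (α′ ⊗ β ⊕ α ⊗ β′ ⊕ α′ ⊗ β′)      ≈⟨ ⊕-congˡ (⊕-assoc _ _ _) ⟩
    α ⊗ β ⊕ (α′ ⊗ β ⊕ (α ⊗ β′ ⊕ α′ ⊗ β′))    ≈⟨ ⊕-assoc _ _ _ ⟨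
    cross α α′ β β′                          ≈⟨ cross≈⊗ α α′ β β′ ⟩
    (α ⊕ α′) ⊗ (β ⊕ β′)                      ∎)

  ⊗-≉0 : ∀ {α β} → α ≉ 0ᵒ → β ≉ 0ᵒ → α ⊗ β ≉ 0ᵒ
  ⊗-≉0 α≉0 β≉0 eq = cross≉0 α≉0 β≉0 (≈-trans (cross≈⊗ _ _ _ _)
    (≈-trans (⊗-cong (⊕-identityʳ _) (⊕-identityʳ _)) eq))

  ⊗-≈0ʳ : ∀ {α β} → α ≉ 0ᵒ → α ⊗ β ≈ 0ᵒ → β ≈ 0ᵒ
  ⊗-≈0ʳ {_} {β} α≉0 eq with <-cmp β 0ᵒ
  ... | tri< β<0 _ _ = contradiction β<0 ≮0
  ... | tri≈ _ β≈0 _ = β≈0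
  ... | tri> _ β≉0 _ = contradiction eq (⊗-≉0 α≉0 β≉0)

  ⊗-assoc : ∀ α β γ → (α ⊗ β) ⊗ γ ≈ α ⊗ (β ⊗ γ)
  ⊗-assoc α β γ = go (<-wellFounded α) (<-wellFounded β) (<-wellFounded γ)
    where
    -- Additive in each argument, so that by induction it does not change
    -- when smaller ordinals are added to its arguments.
    defect : On → On → On → On
    defect α β γ = (α ⊗ β) ⊗ γ ⊕ α ⊗ (β ⊗ γ)

    drop : ∀ {α β γ δ ε ζ} → γ ≈ ζ → α ≈ β ⊕ γ → δ ≈ ε ⊕ ζ → α ⊕ δ ≈ β ⊕ ε
    drop {α} {β} {γ} {δ} {ε} {ζ} γ≈ζ α≈ δ≈ = begin
      α ⊕ δ              ≈⟨ ⊕-cong α≈ δ≈ ⟩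
      β ⊕ γ ⊕ (ε ⊕ ζ)    ≈⟨ interchange β γ ε ζ ⟩
      β ⊕ ε ⊕ (γ ⊕ ζ)    ≈⟨ ⊕-congˡ (≈⇒⊕≈0 γ≈ζ) ⟩
      β ⊕ ε ⊕ 0ᵒ         ≈⟨ ⊕-identityʳ _ ⟩
      β ⊕ ε              ∎

    dropˡ : ∀ {α α′ β γ} → (α′ ⊗ β) ⊗ γ ≈ α′ ⊗ (β ⊗ γ) →
            defect (α ⊕ α′) β γ ≈ defect α β γ
    dropˡ eq = drop eq
      (≈-trans (⊗-congʳ (⊗-distribʳ _ _ _)) (⊗-distribʳ _ _ _))
      (⊗-distribʳ _ _ _)

    dropᵐ : ∀ {α β β′ γ} → (α ⊗ β′) ⊗ γ ≈ α ⊗ (β′ ⊗ γ) →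
            defect α (β ⊕ β′) γ ≈ defect α β γ
    dropᵐ eq = drop eq
      (≈-trans (⊗-congʳ (⊗-distribˡ _ _ _)) (⊗-distribʳ _ _ _))
      (≈-trans (⊗-congˡ (⊗-distribʳ _ _ _)) (⊗-distribˡ _ _ _))

    dropʳ : ∀ {α β γ γ′} → (α ⊗ β) ⊗ γ′ ≈ α ⊗ (β ⊗ γ′) →
            defect α β (γ ⊕ γ′) ≈ defect α β γ
    dropʳ eq = drop eq (⊗-distribˡ _ _ _)
      (≈-trans (⊗-congˡ (⊗-distribˡ _ _ _)) (⊗-distribˡ _ _ _))

    go : ∀ {α β γ} → Acc _<_ α → Acc _<_ β → Acc _<_ γ →
         (α ⊗ β) ⊗ γ ≈ α ⊗ (β ⊗ γ)
    go {α} {β} {γ} (acc r) (acc s) (acc t) = ≮∧≯⇒≈ left right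
      where
      module _ {α′ β′ γ′} (α′<α : α′ < α) (β′<β : β′ < β) (γ′<γ : γ′ < γ) where
        a = α ⊕ α′
        b = β ⊕ β′
        c = γ ⊕ γ′

        a≉0 : a ≉ 0ᵒ
        a≉0 eq = <⇒≉ α′<α (≈-sym (⊕≈0⇒≈ eq))
        b≉0 : b ≉ 0ᵒ
        b≉0 eq = <⇒≉ β′<β (≈-sym (⊕≈0⇒≈ eq))
        c≉0 : c ≉ 0ᵒ
        c≉0 eq = <⇒≉ γ′<γ (≈-sym (⊕≈0⇒≈ eq))

        sumˡ : ∀ {β γ} → (α ⊗ β) ⊗ γ ≈ α ⊗ (β ⊗ γ) →
               (α′ ⊗ β) ⊗ γ ≈ α′ ⊗ (β ⊗ γ) → (a ⊗ β) ⊗ γ ≈ a ⊗ (β ⊗ γ)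
        sumˡ eq eq′ = ⊕≈0⇒≈ (≈-trans (dropˡ eq′) (≈⇒⊕≈0 eq))

        sumᵐ : ∀ {γ} → (a ⊗ β) ⊗ γ ≈ a ⊗ (β ⊗ γ) →
               (a ⊗ β′) ⊗ γ ≈ a ⊗ (β′ ⊗ γ) → (a ⊗ b) ⊗ γ ≈ a ⊗ (b ⊗ γ)
        sumᵐ eq eq′ = ⊕≈0⇒≈ (≈-trans (dropᵐ eq′) (≈⇒⊕≈0 eq))

        expand : defect a b c ≈ defect α β γ
        expand = begin
          defect a b c
            ≈⟨ dropʳ (sumᵐ (sumˡ (go (acc r) (acc s) (t γ′<γ))
                                 (go (r α′<α) (acc s) (t γ′<γ)))
                           (sumˡ (go (acc r) (s β′<β) (t γ′<γ))
                                 (go (r α′<α) (s β′<β) (t γ′<γ)))) ⟩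
          defect a b γ
            ≈⟨ dropᵐ (sumˡ (go (acc r) (s β′<β) (acc t))
                           (go (r α′<α) (s β′<β) (acc t))) ⟩
          defect a β γ
            ≈⟨ dropˡ (go (r α′<α) (acc s) (acc t)) ⟩
          defect α β γ ∎

      -- Two uses of `⊗-below′` write the defect of α, β, γ as `a ⊗ (b ⊗ c)`. By `expand` it is also
      -- the defect of a, b, c, so `(a ⊗ b) ⊗ c` would be zero although its factors are not.
      left : ¬ ((α ⊗ β) ⊗ γ < α ⊗ (β ⊗ γ))
      left lt =
        let (α′ , δ , α′<α , δ< , eq) = ⊗-below′ lt
            (β′ , γ′ , β′<β , γ′<γ , eq′) = ⊗-below′ δ<
        in ⊗-≉0 (⊗-≉0 (a≉0 α′<α β′<β γ′<γ) (b≉0 α′<α β′<β γ′<γ)) (c≉0 α′<α β′<β γ′<γ)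
             (⊕-cancelʳ (≈-trans (expand α′<α β′<β γ′<γ)
               (≈-trans eq
                 (≈-trans (⊗-congˡ (≈-trans (⊕-comm _ _) eq′)) (≈-sym (⊕-identityˡ _))))))

      right : ¬ (α ⊗ (β ⊗ γ) < (α ⊗ β) ⊗ γ)
      right lt =
        let (δ , γ′ , δ< , γ′<γ , eq) = ⊗-below′ lt
            (α′ , β′ , α′<α , β′<β , eq′) = ⊗-below′ δ<
        in ⊗-≉0 (a≉0 α′<α β′<β γ′<γ) (⊗-≉0 (b≉0 α′<α β′<β γ′<γ) (c≉0 α′<α β′<β γ′<γ))
             (⊕-cancelˡ (≈-trans (expand α′<α β′<β γ′<γ)
               (≈-trans (⊕-comm _ _) (≈-trans eq
                 (≈-trans (⊗-congʳ (≈-trans (⊕-comm _ _) eq′)) (≈-sym (⊕-identityʳ _)))))))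

  commutativeRing : CommutativeRing (lsuc 0ℓ) (lsuc 0ℓ)
  commutativeRing = record
    { Carrier           = On
    ; _≈_               = _≈_
    ; _+_               = _⊕_
    ; _*_               = _⊗_
    ; -_                = id
    ; 0#                = 0ᵒ
    ; 1#                = 1ᵒ
    ; isCommutativeRing = record
      { isRing = record
        { +-isAbelianGroup = AbelianGroup.isAbelianGroup ⊕-abelianGroup
        ; *-cong           = ⊗-cong
        ; *-assoc          = ⊗-assoc
        ; *-identity       = ⊗-identityˡ , ⊗-identityʳ
        ; distrib          = ⊗-distribˡ , ⊗-distribʳ
        }
      ; *-comm = ⊗-comm
      }
    }

  -- Coefficients in 𝔽₂ make the solver aware of α ⊕ α ≈ 0ᵒ.
  module Char2Solver where

    ⟦_⟧₂ : Bool → On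
    ⟦ b ⟧₂ = if b then 1ᵒ else 0ᵒ

    𝔽₂⟶On : CommutativeRing.rawRing xor-∧-commutativeRing
            -Raw-AlmostCommutative⟶ fromCommutativeRing commutativeRing
    𝔽₂⟶On = record
      { ⟦_⟧    = ⟦_⟧₂
      ; +-homo = λ { true  true  → ≈-sym (⊕-self 1ᵒ)
                   ; true  false → ≈-sym (⊕-identityʳ 1ᵒ)
                   ; false b     → ≈-sym (⊕-identityˡ ⟦ b ⟧₂) }
      ; *-homo = λ { true  b → ≈-sym (⊗-identityˡ ⟦ b ⟧₂)
                   ; false b → ≈-sym (⊗-zeroˡ ⟦ b ⟧₂) }
      ; -‿homo = λ _ → ≈-refl
      ; 0-homo = ≈-refl
      ; 1-homo = ≈-refl
      }

    _≟₂_ : ∀ b c → Maybe (⟦ b ⟧₂ ≈ ⟦ c ⟧₂)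
    b ≟₂ c = Maybe.map (λ { ≡.refl → ≈-refl }) (dec⇒maybe (b ≟ c))

    open RingSolver _ _ 𝔽₂⟶On _≟₂_ public

  -- Polynomials over the field of all ordinals

  -- Horner's rule, constant coefficient first. Leading coefficients may vanish, so the length only
  -- bounds the degree.
  eval : ∀ {n} → Vec On n → On → On
  eval []       x = 0ᵒ
  eval (a ∷ as) x = a ⊕ x ⊗ eval as x

  eval-cong : ∀ {n x y} {as bs : Vec On n} → Pointwise _≈_ as bs → x ≈ y →
              eval as x ≈ eval bs y
  eval-cong []          _   = ≈-refl
  eval-cong (a≈b ∷ as≈bs) x≈y = ⊕-cong a≈b (⊗-cong x≈y (eval-cong as≈bs x≈y))

  eval-zero : ∀ {n} {as : Vec On n} x → All (_≈ 0ᵒ) as → eval as x ≈ 0ᵒ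
  eval-zero x []           = ≈-refl
  eval-zero x (a≈0 ∷ as≈0) = ≈-trans
    (⊕-cong a≈0 (≈-trans (⊗-congˡ (eval-zero x as≈0)) (⊗-zeroʳ x)))
    (⊕-identityʳ 0ᵒ)

  infixl 6 _⊞_
  _⊞_ : ∀ {n} → Vec On n → Vec On n → Vec On n
  _⊞_ = zipWith _⊕_

  eval-⊞ : ∀ {n} (as bs : Vec On n) x →
           eval (as ⊞ bs) x ≈ eval as x ⊕ eval bs x
  eval-⊞ []       []       x = ≈-sym (⊕-identityʳ 0ᵒ)
  eval-⊞ (a ∷ as) (b ∷ bs) x = ≈-trans
    (⊕-congˡ (⊗-congˡ (eval-⊞ as bs x)))
    (solve 5 (λ a b x p q →
      (a :+ b) :+ x :* (p :+ q) := (a :+ x :* p) :+ (b :+ x :* q))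
      ≈-refl a b x (eval as x) (eval bs x))
    where open Char2Solver

  -- The coefficients of b + (x + d) · as(x).
  linearTimes : ∀ {n} → On → On → Vec On n → Vec On (suc n)
  linearTimes d b []       = b ∷ []
  linearTimes d b (a ∷ as) = b ⊕ d ⊗ a ∷ linearTimes d a as

  eval-linearTimes : ∀ {n} d b (as : Vec On n) x →
    eval (linearTimes d b as) x ≈ b ⊕ (x ⊕ d) ⊗ eval as x
  eval-linearTimes d b []       x = solve 3 (λ b x d →
    b :+ x :* con false := b :+ (x :+ d) :* con false) ≈-refl b x d
    where open Char2Solver
  eval-linearTimes d b (a ∷ as) x = ≈-trans
    (⊕-congˡ (⊗-congˡ (eval-linearTimes d a as x)))
    (solve 5 (λ b d a x p →
      (b :+ d :* a) :+ x :* (a :+ (x :+ d) :* p) :=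
      b :+ (x :+ d) :* (a :+ x :* p)) ≈-refl b d a x (eval as x))
    where open Char2Solver

  -- The quotient of a + x · as(x) by x + r, which does not depend on a.
  quotient : ∀ {n} → On → Vec On n → Vec On n
  quotient r []       = []
  quotient r (a ∷ as) = eval (a ∷ as) r ∷ quotient r as

  -- Synthetic division: the coefficients of the quotient are the intermediate values of Horner's
  -- rule at r, and the remainder is the final one.
  eval-quotient : ∀ {n} r a (as : Vec On n) x →
    eval (a ∷ as) x ≈ eval (a ∷ as) r ⊕ (x ⊕ r) ⊗ eval (quotient r as) x
  eval-quotient r a []       x = solve 3 (λ a x r →
    a :+ x :* con false := (a :+ r :* con false) :+ (x :+ r) :* con false)
    ≈-refl a x r
    where open Char2Solver
  eval-quotient r a (b ∷ bs) x = ≈-trans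
    (⊕-congˡ (⊗-congˡ (eval-quotient r b bs x)))
    (solve 5 (λ a x s r t →
      a :+ x :* (s :+ (x :+ r) :* t) :=
      (a :+ r :* s) :+ (x :+ r) :* (s :+ x :* t))
      ≈-refl a x (eval (b ∷ bs) r) r (eval (quotient r bs) x))
    where open Char2Solver

  -- From the top down: once the higher coefficients vanish, the value at r of the remaining tail is
  -- its first coefficient.
  quotient≈0⇒≈0 : ∀ {n} r {as : Vec On n} →
                  All (_≈ 0ᵒ) (quotient r as) → All (_≈ 0ᵒ) as
  quotient≈0⇒≈0 r {[]}     []           = []
  quotient≈0⇒≈0 r {a ∷ as} (root ∷ quotient≈0) = a≈0 ∷ as≈0
    where
    as≈0 : All (_≈ 0ᵒ) as
    as≈0 = quotient≈0⇒≈0 r quotient≈0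

    a≈0 : a ≈ 0ᵒ
    a≈0 = begin
      a                 ≈⟨ ⊕-identityʳ a ⟨
      a ⊕ 0ᵒ            ≈⟨ ⊕-congˡ (⊗-zeroʳ r) ⟨
      a ⊕ r ⊗ 0ᵒ        ≈⟨ ⊕-congˡ (⊗-congˡ (eval-zero r as≈0)) ⟨
      a ⊕ r ⊗ eval as r ≈⟨ root ⟩
      0ᵒ                ∎

  -- Roots of polynomials

  module Reflecting (Δ : On)
    (0<Δ      : 0ᵒ < Δ)
    (⊕-closed : ∀ {α β} → α < Δ → β < Δ → α ⊕ β < Δ)
    (⊗-closed : ∀ {α β} → α < Δ → β < Δ → α ⊗ β < Δ)
    (reflects : ∀ {n} (as : Vec On n) → All (_< Δ) as → eval as Δ ≈ 0ᵒ →
                ∃[ r ] r < Δ × eval as r ≈ 0ᵒ)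
    where

    eval-closed : ∀ {n} {as : Vec On n} {x} → All (_< Δ) as → x < Δ → eval as x < Δ
    eval-closed []          _  = 0<Δ
    eval-closed (a< ∷ as<) x< = ⊕-closed a< (⊗-closed x< (eval-closed as< x<))

    ⊞-closed : ∀ {n} {as bs : Vec On n} →
               All (_< Δ) as → All (_< Δ) bs → All (_< Δ) (as ⊞ bs)
    ⊞-closed []         []         = []
    ⊞-closed (a< ∷ as<) (b< ∷ bs<) = ⊕-closed a< b< ∷ ⊞-closed as< bs<

    linearTimes-closed : ∀ {n d b} {as : Vec On n} → d < Δ → b < Δ →
      All (_< Δ) as → All (_< Δ) (linearTimes d b as)
    linearTimes-closed d< b< []         = b< ∷ []
    linearTimes-closed d< b< (a< ∷ as<) =
      ⊕-closed b< (⊗-closed d< a<) ∷ linearTimes-closed d< a< as<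

    quotient-closed : ∀ {n r} {as : Vec On n} → r < Δ →
      All (_< Δ) as → All (_< Δ) (quotient r as)
    quotient-closed r< []         = []
    quotient-closed r< (a< ∷ as<) = eval-closed (a< ∷ as<) r< ∷ quotient-closed r< as<

    -- Induction on the length. Reflection gives a root r in Δ; since `Δ ⊕ r` is nonzero, the
    -- quotient by x + r still vanishes at Δ.
    transcendental : ∀ {n} (as : Vec On n) → All (_< Δ) as →
                     eval as Δ ≈ 0ᵒ → All (_≈ 0ᵒ) as
    transcendental []       _              _  = []
    transcendental (a ∷ as) (a<Δ ∷ as<Δ) eq =
      let (r , r<Δ , root) = reflects (a ∷ as) (a<Δ ∷ as<Δ) eq
          product≈0 = begin
            (Δ ⊕ r) ⊗ eval (quotient r as) Δ                      ≈⟨ ⊕-identityˡ _ ⟨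
            0ᵒ ⊕ (Δ ⊕ r) ⊗ eval (quotient r as) Δ                 ≈⟨ ⊕-congʳ root ⟨
            eval (a ∷ as) r ⊕ (Δ ⊕ r) ⊗ eval (quotient r as) Δ    ≈⟨ eval-quotient r a as Δ ⟨
            eval (a ∷ as) Δ                                       ≈⟨ eq ⟩
            0ᵒ                                                    ∎
          quotient≈0 = transcendental (quotient r as) (quotient-closed r<Δ as<Δ)
            (⊗-≈0ʳ (λ Δ⊕r≈0 → <⇒≉ r<Δ (≈-sym (⊕≈0⇒≈ Δ⊕r≈0))) product≈0)
      -- The first entry of `quotient r (a ∷ as)` is the value at r, which is zero.
      in quotient≈0⇒≈0 r {a ∷ as} (root ∷ quotient≈0)

    -- a + x · as(x) + (x + d) · (as(x) + bs(x))
    reduce : ∀ {n} → On → On → Vec On n → Vec On n → Vec On (suc n)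
    reduce d a as bs = (a ∷ as) ⊞ linearTimes d 0ᵒ (as ⊞ bs)

    eval-reduce : ∀ {n} d a (as bs : Vec On n) x →
      eval (reduce d a as bs) x ≈ eval (a ∷ as) x ⊕ (x ⊕ d) ⊗ (eval as x ⊕ eval bs x)
    eval-reduce d a as bs x = ≈-trans
      (eval-⊞ (a ∷ as) (linearTimes d 0ᵒ (as ⊞ bs)) x) (⊕-congˡ
      (≈-trans (eval-linearTimes d 0ᵒ (as ⊞ bs) x) (≈-trans (⊕-identityˡ _)
        (⊗-congˡ (eval-⊞ as bs x)))))

    reduce-closed : ∀ {n d a} {as bs : Vec On n} → d < Δ → a < Δ →
      All (_< Δ) as → All (_< Δ) bs → All (_< Δ) (reduce d a as bs)
    reduce-closed d< a< as< bs< = ⊞-closed (a< ∷ as<)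
      (linearTimes-closed d< 0<Δ (⊞-closed as< bs<))

    -- Mutual induction with `eval-downClosed`, which applies to the shorter `as` and preserves
    -- length; hence `reduce d a as bs` is no longer than `a ∷ as`.
    descend : ∀ {n} a (as : Vec On n) → All (_< Δ) as → ∀ {ζ} → ζ < eval (a ∷ as) Δ →
      (∃[ a′ ] a′ < a × ζ ≈ eval (a′ ∷ as) Δ) ⊎
      (∃[ d ] ∃[ bs ] d < Δ × All (_< Δ) bs × ζ ≈ eval (reduce d a as bs) Δ)

    -- Δ[Δ] is an initial segment of the ordinals.
    eval-downClosed : ∀ {n} (as : Vec On n) → All (_< Δ) as → ∀ {ζ} → ζ < eval as Δ →
      ∃[ bs ] All (_< Δ) bs × ζ ≈ eval {n} bs Δ

    descend a as as<Δ {ζ} ζ< with ⊕-below ζ<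
    ... | inj₁ left = inj₁ left
    ... | inj₂ (η , η< , ζ≈) with ⊗-below′ η<
    ...   | d , v , d<Δ , v< , η≈ with eval-downClosed as as<Δ v<
    ...     | bs , bs<Δ , v≈ = inj₂ (d , bs , d<Δ , bs<Δ , (begin
      ζ
        ≈⟨ ζ≈ ⟩
      a ⊕ η
        -- The product `Δ ⊗ eval as Δ` is inserted twice, which changes nothing in characteristic 2
        -- and prepares for `η≈`.
        ≈⟨ solve 3 (λ a η p → a :+ η := (a :+ p) :+ (η :+ p)) ≈-refl a η _ ⟩
      eval (a ∷ as) Δ ⊕ (η ⊕ Δ ⊗ eval as Δ)
        ≈⟨ ⊕-congˡ η≈ ⟩
      eval (a ∷ as) Δ ⊕ (Δ ⊕ d) ⊗ (eval as Δ ⊕ v)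
        ≈⟨ ⊕-congˡ (⊗-congˡ (⊕-congˡ v≈)) ⟩
      eval (a ∷ as) Δ ⊕ (Δ ⊕ d) ⊗ (eval as Δ ⊕ eval bs Δ)
        ≈⟨ eval-reduce d a as bs Δ ⟨
      eval (reduce d a as bs) Δ ∎))
      where open Char2Solver using (solve; _:+_; _:=_)

    eval-downClosed []       []             ζ<0 = contradiction ζ<0 ≮0
    eval-downClosed (a ∷ as) (a<Δ ∷ as<Δ) ζ< with descend a as as<Δ ζ<
    ... | inj₁ (a′ , a′<a , ζ≈) = a′ ∷ as , <-trans a′<a a<Δ ∷ as<Δ , ζ≈
    ... | inj₂ (d , bs , d<Δ , bs<Δ , ζ≈) =
      reduce d a as bs , reduce-closed d<Δ a<Δ as<Δ bs<Δ , ζ≈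

    root : ∀ {n} a (as : Vec On n) → a < Δ → All (_< Δ) as → ¬ All (_≈ 0ᵒ) as →
           ∃[ r ] r < Δ × eval (a ∷ as) r ≈ 0ᵒ
    root a as a<Δ as<Δ as≉0 with descend a as as<Δ (0<⇐≉0 nonzero)
      where
      nonzero : eval (a ∷ as) Δ ≉ 0ᵒ
      nonzero eq = as≉0 (All.tail (transcendental (a ∷ as) (a<Δ ∷ as<Δ) eq))
    ... | inj₁ (a′ , a′<a , 0≈) = contradiction
      (All.tail (transcendental (a′ ∷ as) (<-trans a′<a a<Δ ∷ as<Δ) (≈-sym 0≈))) as≉0
    ... | inj₂ (d , bs , d<Δ , bs<Δ , 0≈) = d , d<Δ , (begin
      eval (a ∷ as) d
        ≈⟨ ⊕-identityʳ _ ⟨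
      eval (a ∷ as) d ⊕ 0ᵒ
        ≈⟨ ⊕-congˡ (⊗-zeroˡ _) ⟨
      eval (a ∷ as) d ⊕ 0ᵒ ⊗ (eval as d ⊕ eval bs d)
        ≈⟨ ⊕-congˡ (⊗-congʳ (⊕-self d)) ⟨
      eval (a ∷ as) d ⊕ (d ⊕ d) ⊗ (eval as d ⊕ eval bs d)
        ≈⟨ eval-reduce d a as bs d ⟨
      eval (reduce d a as bs) d
        ≈⟨ eval-zero d (transcendental (reduce d a as bs)
             (reduce-closed d<Δ a<Δ as<Δ bs<Δ) (≈-sym 0≈)) ⟩
      0ᵒ ∎)

  -- Power sums as Horner evaluations

  module _ {c ℓ} (R : CommutativeRing c ℓ) {φ : CommutativeRing.Carrier R → On}
    (φ-isHomomorphism : IsRingHomomorphism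
      (CommutativeRing.rawRing R) (CommutativeRing.rawRing commutativeRing) φ)
    where

    open CommutativeRing R
      using (Carrier; _+_; _*_; semiring; *-commutativeSemigroup;
             *-identityʳ; +-cong; trans; sym)
      renaming (_≈_ to _≈ᴿ_)
    open SemiringSum semiring using (sum; sum-cong-≋; *-distribˡ-sum)
    open SemiringExp semiring using (_^_)
    open CommutativeSemigroupProperties *-commutativeSemigroup using (x∙yz≈y∙xz)
    open IsRingHomomorphism φ-isHomomorphism using (⟦⟧-cong; +-homo; *-homo; 0#-homo)

    powerSum-suc : ∀ {n} (a : Fin (suc n) → Carrier) x →
      sum (λ i → a i * x ^ toℕ i) ≈ᴿ a zero + x * sum (λ i → a (suc i) * x ^ toℕ i)
    powerSum-suc a x = +-cong (*-identityʳ (a zero)) (trans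
      (sum-cong-≋ λ i → x∙yz≈y∙xz (a (suc i)) x (x ^ toℕ i))
      (sym (*-distribˡ-sum x λ i → a (suc i) * x ^ toℕ i)))

    powerSum≈eval : ∀ {n} (a : Fin n → Carrier) x →
      φ (sum λ i → a i * x ^ toℕ i) ≈ eval (tabulate λ i → φ (a i)) (φ x)
    powerSum≈eval {zero}  a x = 0#-homo
    powerSum≈eval {suc n} a x = begin
      φ (sum λ i → a i * x ^ toℕ i)
        ≈⟨ ⟦⟧-cong (powerSum-suc a x) ⟩
      φ (a zero + x * sum λ i → a (suc i) * x ^ toℕ i)
        ≈⟨ +-homo _ _ ⟩
      φ (a zero) ⊕ φ (x * sum λ i → a (suc i) * x ^ toℕ i)
        ≈⟨ ⊕-congˡ (*-homo _ _) ⟩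
      φ (a zero) ⊕ φ x ⊗ φ (sum λ i → a (suc i) * x ^ toℕ i)
        ≈⟨ ⊕-congˡ (⊗-congˡ (powerSum≈eval (λ i → a (suc i)) x)) ⟩
      eval (tabulate λ i → φ (a i)) (φ x) ∎

  -- Closure of ω₁

  module Omega₁ {ω₁ : On} (ω₁-least : IsLeast Uncountable ω₁) where

    open Countability em
    open Least ω₁-least

    -- Everything below the sum is an option, and covers of α and β enumerate the options: row 0
    -- varies α, the other rows vary β.
    ⊕-<ω₁ : ∀ {α β} → α < ω₁ → β < ω₁ → α ⊕ β < ω₁
    ⊕-<ω₁ {α} {β} α<ω₁ β<ω₁ =
      let (e , _ , cover)  = covers-<ω₁ α<ω₁
          (e′ , _ , cover′) = covers-<ω₁ β<ω₁
      in countable⇒<ω₁ (covers²⇒countable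
        (λ { zero n → e n ⊕ β ; (suc _) n → α ⊕ e′ n }) λ ζ< →
        [ (λ (α′ , α′<α , ζ≈) → let (n , α′≈) = cover α′<α in
            0 , n , ≈-trans ζ≈ (⊕-congʳ α′≈))
        , (λ (β′ , β′<β , ζ≈) → let (n , β′≈) = cover′ β′<β in
            1 , n , ≈-trans ζ≈ (⊕-congˡ β′≈))
        ] (⊕-below ζ<))

    ⊗-<ω₁ : ∀ {α β} → α < ω₁ → β < ω₁ → α ⊗ β < ω₁
    ⊗-<ω₁ {α} {β} α<ω₁ β<ω₁ =
      let (e , _ , cover)  = covers-<ω₁ α<ω₁
          (e′ , _ , cover′) = covers-<ω₁ β<ω₁
      in countable⇒<ω₁ (covers²⇒countable
        (λ m n → e m ⊗ β ⊕ α ⊗ e′ n ⊕ e m ⊗ e′ n) λ ζ< →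
        let (α′ , β′ , α′<α , β′<β , ζ≈) = ⊗-below ζ<
            (m , α′≈) = cover α′<α
            (n , β′≈) = cover′ β′<β
        in m , n , ≈-trans ζ≈
             (⊕-cong (⊕-cong (⊗-congʳ α′≈) (⊗-congˡ β′≈)) (⊗-cong α′≈ β′≈)))

    HasRoot : ∀ {n} → Vec On n → Set₁
    HasRoot as = ∃[ r ] r < ω₁ × eval as r ≈ 0ᵒ

    -- Excluded middle acts as a choice of roots; the default `0ᵒ` keeps the value countable.
    select : ∀ {n} (as : Vec On n) → Dec (HasRoot as) → On
    select as (yes (r , _)) = r
    select as (no _)        = 0ᵒ

    select<ω₁ : ∀ {n} (as : Vec On n) d → select as d < ω₁
    select<ω₁ as (yes (_ , r<ω₁ , _)) = r<ω₁
    select<ω₁ as (no _)               = 0<ω₁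

    select-root : ∀ {n} (as : Vec On n) d → HasRoot as → eval as (select as d) ≈ 0ᵒ
    select-root as (yes (_ , _ , root)) _    = root
    select-root as (no none)            has  = contradiction has none

    -- The operations for `Closure`, each in every arity: iterated sum, iterated product, chosen
    -- root.
    ops : ∀ {n} → ℕ → Vec On n → On
    ops 0 as = foldr′ _⊕_ 0ᵒ as
    ops 1 as = foldr′ _⊗_ 1ᵒ as
    ops _ as = select as em

    ops<ω₁ : ∀ {n} j (as : Vec On n) → All (_< ω₁) as → ops j as < ω₁
    ops<ω₁ 0 []       []            = 0<ω₁
    ops<ω₁ 0 (a ∷ as) (a< ∷ as<) = ⊕-<ω₁ a< (ops<ω₁ 0 as as<)
    ops<ω₁ 1 []       []            = 1<ω₁
    ops<ω₁ 1 (a ∷ as) (a< ∷ as<) = ⊗-<ω₁ a< (ops<ω₁ 1 as as<)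
    ops<ω₁ (suc (suc _)) as _       = select<ω₁ as em

    root-<ω₁ : ∀ {n} a (as : Vec On n) → a < ω₁ → All (_< ω₁) as → ¬ All (_≈ 0ᵒ) as →
               HasRoot (a ∷ as)
    root-<ω₁ a as a<ω₁ as<ω₁ as≉0 =
      let (r , r<Δ , eq) = Reflecting.root Δ 0<Δ ⊕-closed ⊗-closed reflects a as
                             (<-trans (All.head as<α) α<closure)
                             (All.map (λ <α → <-trans <α α<closure) (All.tail as<α)) as≉0
      in r , <-trans r<Δ closure<ω₁ , eq
      where
      bound = upperBound (a<ω₁ ∷ as<ω₁)
      as<α  = proj₂ (proj₂ bound)

      open Closure ops ops<ω₁ (proj₁ (proj₂ bound)) renaming (closure to Δ)

      0<Δ : 0ᵒ < Δ
      0<Δ = let (_ , _ , <Δ) = closed 0 [] in ≤-<-trans (sup≤ λ ()) <Δ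

      ⊕-closed : ∀ {α β} → α < Δ → β < Δ → α ⊕ β < Δ
      ⊕-closed α<Δ β<Δ with closed 0 (α<Δ ∷ β<Δ ∷ [])
      -- What lies below Δ is the fold over representatives of α and β, which carries a final `0ᵒ`.
      ... | _ , α≈ ∷ β≈ ∷ [] , <Δ =
        <-respˡ-≈ (≈-sym (⊕-cong α≈ (≈-trans β≈ (≈-sym (⊕-identityʳ _))))) <Δ

      ⊗-closed : ∀ {α β} → α < Δ → β < Δ → α ⊗ β < Δ
      ⊗-closed α<Δ β<Δ with closed 1 (α<Δ ∷ β<Δ ∷ [])
      ... | _ , α≈ ∷ β≈ ∷ [] , <Δ =
        <-respˡ-≈ (≈-sym (⊗-cong α≈ (≈-trans β≈ (≈-sym (⊗-identityʳ _))))) <Δ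

      reflects : ∀ {n} (as : Vec On n) → All (_< Δ) as → eval as Δ ≈ 0ᵒ →
                 ∃[ r ] r < Δ × eval as r ≈ 0ᵒ
      reflects as as<Δ eq =
        -- Δ is itself a countable root of `bs`, so the selected value is a genuine root, and
        -- closure puts it below Δ.
        let (bs , as≈bs , r<Δ) = closed 2 as<Δ
        in _ , r<Δ , ≈-trans (eval-cong as≈bs ≈-refl) (select-root bs em
             (Δ , closure<ω₁ , ≈-trans (≈-sym (eval-cong as≈bs ≈-refl)) eq))

  -- Algebraically closed fields from closure under roots

  module RootClosed {Ω : On} (0<Ω : 0ᵒ < Ω) (1<Ω : 1ᵒ < Ω)
    (⊕-<Ω : ∀ {α β} → α < Ω → β < Ω → α ⊕ β < Ω)
    (⊗-<Ω : ∀ {α β} → α < Ω → β < Ω → α ⊗ β < Ω)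
    (root-<Ω : ∀ {n} a (as : Vec On n) → a < Ω → All (_< Ω) as → ¬ All (_≈ 0ᵒ) as →
               ∃[ r ] r < Ω × eval (a ∷ as) r ≈ 0ᵒ)
    where

    Carrier : Set₁
    Carrier = Setoid.Carrier (Below Ω)

    rawRing : RawRing _ _
    rawRing = record
      { Carrier = Carrier
      ; _≈_     = λ x y → proj₁ x ≈ proj₁ y
      ; _+_     = λ (α , α<) (β , β<) → α ⊕ β , ⊕-<Ω α< β<
      ; _*_     = λ (α , α<) (β , β<) → α ⊗ β , ⊗-<Ω α< β<
      ; -_      = id
      ; 0#      = 0ᵒ , 0<Ω
      ; 1#      = 1ᵒ , 1<Ω
      }

    -- Lets the ring laws of On₂ be pulled back to Ω along the inclusion.
    proj₁-isRingMonomorphism :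
      IsRingMonomorphism rawRing (CommutativeRing.rawRing commutativeRing) proj₁
    proj₁-isRingMonomorphism = record
      { isRingHomomorphism = record
        { isSemiringHomomorphism = record
          { isNearSemiringHomomorphism = record
            { +-isMonoidHomomorphism = record
              { isMagmaHomomorphism = record
                { isRelHomomorphism = record { cong = id }
                ; homo = λ _ _ → ≈-refl
                }
              ; ε-homo = ≈-refl
              }
            ; *-homo = λ _ _ → ≈-refl
            }
          ; 1#-homo = ≈-refl
          }
        ; -‿homo = λ _ → ≈-refl
        }
      ; injective = id
      }

    isCommutativeRing : IsCommutativeRing _ _ _ _ _ _
    isCommutativeRing = RingMonomorphism.isCommutativeRing proj₁-isRingMonomorphism
      (CommutativeRing.isCommutativeRing commutativeRing)

    Ω-commutativeRing : CommutativeRing _ _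
    Ω-commutativeRing = record { isCommutativeRing = isCommutativeRing }

    1≉0 : 1ᵒ ≉ 0ᵒ
    1≉0 1≈0 = <⇒≉ 0<1 (≈-sym 1≈0)

    inverse : ∀ (x : Carrier) → proj₁ x ≉ 0ᵒ →
              ∃ λ (y : Carrier) → proj₁ x ⊗ proj₁ y ≈ 1ᵒ
    inverse (α , α<Ω) α≉0 = fromRoot
      -- A root r of 1 + α x satisfies `r ⊗ α ≈ 1ᵒ` in characteristic 2.
      (root-<Ω 1ᵒ (α ∷ []) 1<Ω (α<Ω ∷ []) λ { (α≈0 ∷ []) → α≉0 α≈0 })
      where
      fromRoot : (∃[ r ] r < Ω × eval (1ᵒ ∷ α ∷ []) r ≈ 0ᵒ) →
                 ∃ λ (y : Carrier) → α ⊗ proj₁ y ≈ 1ᵒ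
      fromRoot (r , r<Ω , 1+rα≈0) = (r , r<Ω) , (begin
        α ⊗ r              ≈⟨ ⊗-comm α r ⟩
        r ⊗ α              ≈⟨ ⊗-congˡ (⊕-identityʳ α) ⟨
        r ⊗ (α ⊕ 0ᵒ)       ≈⟨ ⊗-congˡ (⊕-congˡ (⊗-zeroʳ r)) ⟨
        r ⊗ (α ⊕ r ⊗ 0ᵒ)   ≈⟨ ⊕≈0⇒≈ 1+rα≈0 ⟨
        1ᵒ                 ∎)

    algebraicallyClosed : IsAlgebraicallyClosed Ω-commutativeRing
    algebraicallyClosed n a leading≉0 = fromRoot
      (root-<Ω (proj₁ (a zero)) (tabulate λ i → proj₁ (a (suc i)))
        (proj₂ (a zero)) (tabulate⁺ λ i → proj₂ (a (suc i)))
        -- As the degree is positive, the leading coefficient is entry `fromℕ n` of the tail.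
        λ all≈0 → leading≉0 (tabulate⁻ {f = λ i → proj₁ (a (suc i))} all≈0 (fromℕ n)))
      where
      open CommutativeRing Ω-commutativeRing using (_*_; semiring)
      open SemiringSum semiring using (sum)
      open SemiringExp semiring using (_^_)

      fromRoot : (∃[ r ] r < Ω × eval (tabulate λ i → proj₁ (a i)) r ≈ 0ᵒ) →
                 ∃ λ (x : Carrier) → proj₁ (sum λ i → a i * x ^ toℕ i) ≈ 0ᵒ
      fromRoot (r , r<Ω , root) = (r , r<Ω) , ≈-trans
        (powerSum≈eval Ω-commutativeRing
          (IsRingMonomorphism.isRingHomomorphism proj₁-isRingMonomorphism) a (r , r<Ω))
        root

-- Application to ω₁

module _ (em : ExcludedMiddle (lsuc 0ℓ)) where

  open Classical em

  nim : NimArithmetic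
  nim = record
    { _⊕_    = _⊕_
    ; _⊗_    = _⊗_
    ; ⊕-cong = ⊕-cong
    ; ⊗-cong = ⊗-cong
    ; ⊕-mex  = ⊕-mex
    ; ⊗-mex  = ⊗-mex
    }

  open NimField em nim using (eval; module RootClosed)

  rootClosed⇒transcendental : ∀ {Ω} → 0ᵒ < Ω → 1ᵒ < Ω →
    (∀ {α β} → α < Ω → β < Ω → α ⊕ β < Ω) →
    (∀ {α β} → α < Ω → β < Ω → α ⊗ β < Ω) →
    (∀ {n} a (as : Vec On n) → a < Ω → All (_< Ω) as → ¬ All (_≈ 0ᵒ) as →
      ∃[ r ] r < Ω × eval (a ∷ as) r ≈ 0ᵒ) →
    IsTranscendental Ω
  rootClosed⇒transcendental {Ω} 0<Ω 1<Ω ⊕-<Ω ⊗-<Ω root-<Ω = record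
    { 0<                    = 0<Ω
    ; 1<                    = 1<Ω
    ; ⊕-closed              = λ {α} {β} → ⊕-<Ω {α} {β}
    ; ⊗-closed              = λ {α} {β} → ⊗-<Ω {α} {β}
    ; -_                    = id
    ; isCommutativeRing     = isCommutativeRing
    ; isField               = record { 1≉0 = 1≉0 ; inverse = inverse }
    ; isAlgebraicallyClosed = algebraicallyClosed
    }
    where
    open RootClosed {Ω} 0<Ω 1<Ω (λ {α} {β} → ⊕-<Ω {α} {β})
      (λ {α} {β} → ⊗-<Ω {α} {β}) root-<Ω

proposition3p6 : (em : ExcludedMiddle (lsuc 0ℓ)) →
    let open Classical em in IsTranscendental ω₁
proposition3p6 em = rootClosed⇒transcendental em 0<ω₁ 1<ω₁
  (λ {α} {β} → ⊕-<ω₁ {α} {β}) (λ {α} {β} → ⊗-<ω₁ {α} {β}) root-<ω₁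
  where
  ω₁-least : IsLeast Uncountable (Classical.ω₁ em)
  ω₁-least = proj₂ (Classical.ω₁-least em)

  open Countability.Least em ω₁-least using (0<ω₁; 1<ω₁)
  open NimField.Omega₁ em (nim em) ω₁-least using (⊕-<ω₁; ⊗-<ω₁; root-<ω₁)
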